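{- For each integer $t\ge 1$ let $M_{\mathrm c}(t)$ be the number of $3\times 3$ magic squares all of whose entries are strictly between $0$ and $t$. Then $$\sum_{t>0} M_{\mathrm c}(t)\,x^t=\frac{8x^{10}(2x^2+1)}{(1-x)^2(1-x^4)(1-x^6)},$$ and for every integer $t\ge 1$ $$M_{\mathrm c}(t)=\begin{cases} \frac{t^3-16t^2+76t-96}{6}, & t\equiv 0,2,6,8 \pmod{12},\\[2pt] \frac{t^3-16t^2+73t-58}{6}, & t\equiv 1 \pmod{12},\\[2pt] \frac{t^3-16t^2+73t-102}{6}, & t\equiv 3,11 \pmod{12},\\[2pt] \frac{t^3-16t^2+76t-112}{6}, & t\equiv 4,10 \pmod{12},\\[2pt] \frac{t^3-16t^2+73t-90}{6}, & t\equiv 5,9 \pmod{12},\\[2pt] \frac{t^3-16t^2+73t-70}{6}, & t\equiv 7 \pmod{12}. \end{cases}$$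
   Context: A $3\times3$ magic square (in the strong sense) is a $3\times 3$ matrix of pairwise distinct positive integers in which all three row sums, all three column sums and both diagonal sums are equal. Squares are counted as matrices (not up to symmetry). -}

module Defs where

open import Data.Fin.Base as Fin using (Fin; toℕ; opposite)
open import Data.Fin.Properties as Fin using (all?)
open import Data.Integer.Base as ℤ using (ℤ; +_; 0ℤ; 1ℤ)
import Data.Integer.Properties as ℤ
open import Data.Integer.Tactic.RingSolver using (solve-∀)
open import Data.List.Base as List using (List; []; _∷_; filter; length; upTo; cartesianProductWith)
open import Data.List.Membership.Propositional using (_∈_)
open import Data.List.Membership.Propositional.Properties
  using (∈-upTo⁺; ∈-cartesianProductWith⁺; ∈-filter⁺; ∈-filter⁻)
open import Data.List.Relation.Unary.All using ([])
open import Data.List.Relation.Unary.Any using (here)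
open import Data.List.Relation.Unary.AllPairs using ([]; _∷_)
open import Data.List.Relation.Unary.Unique.Propositional using (Unique)
import Data.List.Relation.Unary.Unique.Propositional.Properties as Unique
open import Data.Nat.Base as ℕ using (ℕ; zero; suc; _<_; _∸_)
import Data.Nat.Properties as ℕ
open import Data.Product.Base using (_×_; _,_; proj₁; proj₂)
open import Data.Vec.Base as Vec using (Vec; []; _∷_; lookup; tabulate)
open import Data.Vec.Properties using (∷-injective)
open import Function.Base using (_∘_)
open import Function.Bundles using (_⇔_; mk⇔)
open import Relation.Binary.PropositionalEquality
  using (_≡_; refl; sym; trans; cong; module ≡-Reasoning)
open import Relation.Nullary.Decidable using (True; toWitness; map′; _×-dec_; _→-dec_)
open import Relation.Unary using (Decidable)
open import Algebra.Properties.Semiring.Sum ℤ.+-*-semiring using (sum)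

------------------------------------------------------------------------
-- Magic squares

Matrix : Set
Matrix = Vec (Vec ℕ 3) 3

entry : Matrix → Fin 3 → Fin 3 → ℕ
entry A i j = lookup (lookup A i) j

rowSum colSum : Matrix → Fin 3 → ℕ
rowSum A i = Vec.sum (tabulate λ j → entry A i j)
colSum A j = Vec.sum (tabulate λ i → entry A i j)

diagonalSum antidiagonalSum : Matrix → ℕ
diagonalSum     A = Vec.sum (tabulate λ i → entry A i i)
antidiagonalSum A = Vec.sum (tabulate λ i → entry A i (opposite i))

record IsMagic (A : Matrix) : Set where
  constructor mkIsMagic
  field
    positive     : ∀ i j → 0 < entry A i j
    distinct     : ∀ i j k l → entry A i j ≡ entry A k l → i ≡ k × j ≡ l
    magicSum     : ℕ
    rows         : ∀ i → rowSum A i ≡ magicSum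
    columns      : ∀ j → colSum A j ≡ magicSum
    diagonal     : diagonalSum A ≡ magicSum
    antidiagonal : antidiagonalSum A ≡ magicSum

EntriesStrictlyBetween : ℕ → ℕ → Matrix → Set
EntriesStrictlyBetween a b A = ∀ i j → a < entry A i j × entry A i j < b

MagicBelow : ℕ → Matrix → Set
MagicBelow t A = IsMagic A × EntriesStrictlyBetween 0 t A

isMagic? : Decidable IsMagic
isMagic? A = map′
  (λ (p , d , r , c , a) → mkIsMagic p d (diagonalSum A) r c refl a)
  (λ m → let open IsMagic m in
     positive , distinct
     , (λ i → trans (rows i) (sym diagonal))
     , (λ j → trans (columns j) (sym diagonal))
     , trans antidiagonal (sym diagonal))
  (    all? (λ i → all? λ j → 0 ℕ.<? entry A i j)
  ×-dec all? (λ i → all? λ j → all? λ k → all? λ l →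
          (entry A i j ℕ.≟ entry A k l) →-dec (i Fin.≟ k ×-dec j Fin.≟ l))
  ×-dec all? (λ i → rowSum A i ℕ.≟ diagonalSum A)
  ×-dec all? (λ j → colSum A j ℕ.≟ diagonalSum A)
  ×-dec (antidiagonalSum A ℕ.≟ diagonalSum A))

magicBelow? : ∀ t → Decidable (MagicBelow t)
magicBelow? t A =
  isMagic? A ×-dec all? λ i → all? λ j → (0 ℕ.<? entry A i j) ×-dec (entry A i j ℕ.<? t)

vectors : ∀ {A : Set} → List A → ∀ n → List (Vec A n)
vectors xs zero    = [] ∷ []
vectors xs (suc n) = cartesianProductWith _∷_ xs (vectors xs n)

magicSquares : ℕ → List Matrix
magicSquares t = filter (magicBelow? t) (vectors (vectors (upTo t) 3) 3)

M-c : ℕ → ℕ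
M-c t = length (magicSquares t)

-- The next two lemmas justify M-c: the list contains every matrix
-- satisfying MagicBelow t, and contains it exactly once.

vectors-complete : ∀ {A : Set} {xs : List A} {n} (v : Vec A n) →
                   (∀ i → lookup v i ∈ xs) → v ∈ vectors xs n
vectors-complete []      h = here refl
vectors-complete (x ∷ v) h =
  ∈-cartesianProductWith⁺ _∷_ (h Fin.zero) (vectors-complete v (h ∘ Fin.suc))

vectors-unique : ∀ {A : Set} {xs : List A} n → Unique xs → Unique (vectors xs n)
vectors-unique zero    u = [] ∷ []
vectors-unique (suc n) u =
  Unique.cartesianProductWith⁺ _∷_ ∷-injective u (vectors-unique n u)

∈-magicSquares : ∀ t A → A ∈ magicSquares t ⇔ MagicBelow t A
∈-magicSquares t A = mk⇔
  (λ A∈ → proj₂ (∈-filter⁻ (magicBelow? t) {xs = vectors (vectors (upTo t) 3) 3} A∈))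
  (λ m → ∈-filter⁺ (magicBelow? t)
    (vectors-complete A λ i → vectors-complete (lookup A i) λ j → ∈-upTo⁺ (proj₂ (proj₂ m i j)))
    m)

magicSquares-unique : ∀ t → Unique (magicSquares t)
magicSquares-unique t =
  Unique.filter⁺ (magicBelow? t) (vectors-unique 3 (vectors-unique 3 (Unique.upTo⁺ t)))

------------------------------------------------------------------------
-- Formal power series over ℤ, as coefficient sequences

Series : Set
Series = ℕ → ℤ

infix  4 _≈ₛ_
infixl 6 _+ₛ_ _-ₛ_
infixl 7 _*ₛ_ _/ₛ_
infixr 8 _^ₛ_

_≈ₛ_ : Series → Series → Set
f ≈ₛ g = ∀ n → f n ≡ g n

const : ℤ → Series
const c zero    = c
const c (suc _) = 0ℤ

x : Series
x 1 = 1ℤ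
x _ = 0ℤ

_+ₛ_ _-ₛ_ _*ₛ_ : Series → Series → Series
(f +ₛ g) n = f n ℤ.+ g n
(f -ₛ g) n = f n ℤ.- g n
(f *ₛ g) n = sum {suc n} λ k → f (toℕ k) ℤ.* g (n ∸ toℕ k)

_^ₛ_ : Series → ℕ → Series
f ^ₛ zero  = const 1ℤ
f ^ₛ suc n = f *ₛ f ^ₛ n

tail : Series → Series
tail f n = f (suc n)

-- Long division by g, valid when g has constant term 1: if f = q g, then
-- q has constant term f 0, and tail q · g = tail f − f 0 · tail g.
divide : Series → Series → Series
divide f g zero    = f 0
divide f g (suc n) = divide (λ k → tail f k ℤ.- f 0 ℤ.* tail g k) g n

_/ₛ_ : (f g : Series) {_ : True (g 0 ℤ.≟ 1ℤ)} → Series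
f /ₛ g = divide f g

/ₛ-*ₛ : ∀ f g {p : True (g 0 ℤ.≟ 1ℤ)} → (_/ₛ_ f g {p}) *ₛ g ≈ₛ f
/ₛ-*ₛ f g {p} = go f
  where
  open ≡-Reasoning
  cancel : ∀ a b → a ℤ.+ (b ℤ.- a) ≡ b
  cancel = solve-∀

  go : ∀ f n → (divide f g *ₛ g) n ≡ f n
  go f zero = begin
    f 0 ℤ.* g 0 ℤ.+ 0ℤ  ≡⟨ ℤ.+-identityʳ _ ⟩
    f 0 ℤ.* g 0         ≡⟨ cong (f 0 ℤ.*_) (toWitness p) ⟩
    f 0 ℤ.* 1ℤ          ≡⟨ ℤ.*-identityʳ (f 0) ⟩
    f 0                 ∎
  go f (suc n) = begin
    f 0 ℤ.* g (suc n) ℤ.+ (divide f′ g *ₛ g) n             ≡⟨ cong (λ z → f 0 ℤ.* g (suc n) ℤ.+ z) (go f′ n) ⟩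
    f 0 ℤ.* g (suc n) ℤ.+ (f (suc n) ℤ.- f 0 ℤ.* g (suc n)) ≡⟨ cancel (f 0 ℤ.* g (suc n)) (f (suc n)) ⟩
    f (suc n)                                               ∎
    where
    f′ : Series
    f′ k = tail f k ℤ.- f 0 ℤ.* tail g k

-- ∑ a(t) xᵗ over t > 0
∑>0 : (ℕ → ℕ) → Series
∑>0 a zero    = 0ℤ
∑>0 a (suc n) = + a (suc n)

{-# OPTIONS --safe #-}

-- A magic square has entries c ± a, c ± b, c ± (a + b), c ± (a − b). Up to the
-- dihedral group, which accounts for the factor 8, the corners are ordered so
-- that a > b > 0, with a ≠ 2b by distinctness; c is free subject to
-- a + b < c < t − (a + b). Splitting into a − 2b odd and positive, a − 2b even
-- and positive, and b < a < 2b, the squares of each kind below t correspond to the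
-- natural solutions of g + h + 4f + 6p = t − 10, t − 12 and t − 12 respectively,
-- counted by the coefficients of 1/((1−x)²(1−x⁴)(1−x⁶)). The closed formula is a
-- quasi-polynomial of period 12 annihilated by the same denominator, so it suffices
-- to compare finitely many coefficients.

module Submission where

open import Defs
open import Data.Nat.Base as ℕ using (ℕ; zero; suc; _≤_)
import Data.Nat.Properties as ℕ
open import Data.Nat.DivMod using (_%_; m≡m%n+[m/n]*n)
import Data.Nat.DivMod as ℕ using (_/_)
open import Data.Nat.Induction using (<-rec)
import Data.Nat.Tactic.RingSolver as ℕ-Solver
open import Data.Integer.Base using (ℤ; +_; _+_; _-_; _*_; _^_; -_; 0ℤ; 1ℤ)
import Data.Integer.Properties as ℤ
open import Data.Integer.Solver using (module +-*-Solver)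
open import Data.Integer.Tactic.RingSolver using (solve-∀)
open import Data.Rational.Base using (ℚ; _/_)
import Data.Rational.Properties as ℚ
open import Data.Rational.Unnormalised.Base using (*≡*; mkℚᵘ)
open import Data.Fin.Base using (Fin; zero; suc; toℕ; opposite)
open import Data.Fin.Patterns using (0F; 1F; 2F)
import Data.Fin.Properties as Fin
open import Data.List.Base using (List; []; _∷_; [_]; _++_; map; length)
open import Data.List.Properties using (length-map; length-++)
open import Data.List.Membership.Propositional using (_∈_)
open import Data.List.Membership.Propositional.Properties using (∈-map⁺; ∈-map⁻; ∈-++⁺ˡ; ∈-++⁺ʳ; ∈-++⁻)
open import Data.List.Membership.Propositional.Properties.WithK using (unique∧set⇒bag)
open import Data.List.Relation.Unary.All as All using (All; []; _∷_)
import Data.List.Relation.Unary.All.Properties as All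
open import Data.List.Relation.Unary.Any using (here; there)
open import Data.List.Relation.Unary.Unique.Propositional using (Unique; []; _∷_)
import Data.List.Relation.Unary.Unique.Propositional.Properties as Unique
open import Data.List.Relation.Binary.BagAndSetEquality using (∼bag⇒↭)
open import Data.List.Relation.Binary.Permutation.Propositional.Properties using (↭-length)
open import Data.Product.Base using (∃; _×_; _,_; proj₁; proj₂; swap)
open import Data.Sum.Base using (_⊎_; inj₁; inj₂; [_,_]′)
open import Data.Vec.Base as Vec using (Vec; []; _∷_; tabulate)
open import Data.Vec.Properties using (lookup∘tabulate)
open import Function.Base using (_∘_; id)
open import Function.Bundles using (_⇔_; mk⇔; Equivalence)
open import Function.Definitions using (Injective)
import Function.Construct.Composition as Comp
import Function.Construct.Symmetry as Sym
open import Relation.Binary.Definitions using (tri<; tri≈; tri>)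
open import Relation.Binary.PropositionalEquality
  using (_≡_; _≢_; refl; sym; trans; cong; cong₂; subst; subst₂; module ≡-Reasoning)
open import Relation.Nullary using (¬_; yes; no; contradiction)
open import Relation.Nullary.Decidable using (from-yes; _×-dec_; _→-dec_)

open +-*-Solver using (Polynomial; con; solve; _:+_; _:*_; _:-_; _:=_)

-- Power series

infixr 7 _·_

_·_ : ℤ → Series → Series
(c · f) n = c * f n

1ₛ : Series
1ₛ = const 1ℤ

shift : ℕ → Series → Series
shift zero    f n       = f n
shift (suc k) f zero    = 0ℤ
shift (suc k) f (suc n) = shift k f n

-- Multiplication by `1 - x^k`, seen as a backward difference of step `k` on coefficients; `*ₛ-1-x^`
-- makes the link.
Δ : ℕ → Series → Series
Δ k f n = f n - shift k f n

≈-sym : ∀ {f g} → f ≈ₛ g → g ≈ₛ f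
≈-sym p n = sym (p n)

≈-trans : ∀ {f g h} → f ≈ₛ g → g ≈ₛ h → f ≈ₛ h
≈-trans p q n = trans (p n) (q n)

shift-cong : ∀ k {f g} → f ≈ₛ g → shift k f ≈ₛ shift k g
shift-cong zero    p n       = p n
shift-cong (suc k) p zero    = refl
shift-cong (suc k) p (suc n) = shift-cong k p n

shift-< : ∀ k f {n} → n ℕ.< k → shift k f n ≡ 0ℤ
shift-< (suc k) f {zero}  _           = refl
shift-< (suc k) f {suc n} (ℕ.s≤s n<k) = shift-< k f n<k

shift-+ : ∀ k f n → shift k f (k ℕ.+ n) ≡ f n
shift-+ zero    f n = refl
shift-+ (suc k) f n = shift-+ k f n

shift-shift : ∀ j k f → shift j (shift k f) ≈ₛ shift (j ℕ.+ k) f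
shift-shift zero    k f n       = refl
shift-shift (suc j) k f zero    = refl
shift-shift (suc j) k f (suc n) = shift-shift j k f n

shift-linear : ∀ k c f g → shift k (c · f +ₛ g) ≈ₛ c · shift k f +ₛ shift k g
shift-linear zero    c f g n       = refl
shift-linear (suc k) c f g zero    = sym (trans (ℤ.+-identityʳ (c * 0ℤ)) (ℤ.*-zeroʳ c))
shift-linear (suc k) c f g (suc n) = shift-linear k c f g n

Δ-cong : ∀ k {f g} → f ≈ₛ g → Δ k f ≈ₛ Δ k g
Δ-cong k p n = cong₂ _-_ (p n) (shift-cong k p n)

-- The coefficient of `f *ₛ g` at `suc n` unfolds definitionally to its first summand plus the
-- coefficient of `tail f *ₛ g` at `n`. The inductions on products below rest on this unfolding.
*ₛ-cong : ∀ {f f′ g g′} → f ≈ₛ f′ → g ≈ₛ g′ → f *ₛ g ≈ₛ f′ *ₛ g′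
*ₛ-cong p q zero    = cong (_+ 0ℤ) (cong₂ _*_ (p 0) (q 0))
*ₛ-cong p q (suc n) =
  cong₂ _+_ (cong₂ _*_ (p 0) (q (suc n))) (*ₛ-cong (λ k → p (suc k)) q n)

*ₛ-congˡ : ∀ f {g g′} → g ≈ₛ g′ → f *ₛ g ≈ₛ f *ₛ g′
*ₛ-congˡ f = *ₛ-cong {f} (λ _ → refl)

*ₛ-congʳ : ∀ g {f f′} → f ≈ₛ f′ → f *ₛ g ≈ₛ f′ *ₛ g
*ₛ-congʳ g p = *ₛ-cong {g = g} p (λ _ → refl)

*ₛ-distribʳ : ∀ h f g → (f +ₛ g) *ₛ h ≈ₛ f *ₛ h +ₛ g *ₛ h
*ₛ-distribʳ h f g zero    = lemma (f 0) (g 0) (h 0)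
  where
  lemma : ∀ a b c → (a + b) * c + 0ℤ ≡ (a * c + 0ℤ) + (b * c + 0ℤ)
  lemma = solve-∀
*ₛ-distribʳ h f g (suc n) =
  trans (cong (λ z → (f 0 + g 0) * h (suc n) + z) (*ₛ-distribʳ h (tail f) (tail g) n))
        (lemma (f 0) (g 0) (h (suc n)) ((tail f *ₛ h) n) ((tail g *ₛ h) n))
  where
  lemma : ∀ a b c d e → (a + b) * c + (d + e) ≡ (a * c + d) + (b * c + e)
  lemma = solve-∀

·-*ₛ : ∀ c f g → (c · f) *ₛ g ≈ₛ c · (f *ₛ g)
·-*ₛ c f g zero    = lemma c (f 0) (g 0)
  where
  lemma : ∀ a b c → a * b * c + 0ℤ ≡ a * (b * c + 0ℤ)
  lemma = solve-∀
·-*ₛ c f g (suc n) =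
  trans (cong (λ z → c * f 0 * g (suc n) + z) (·-*ₛ c (tail f) g n))
        (lemma c (f 0) (g (suc n)) ((tail f *ₛ g) n))
  where
  lemma : ∀ a b c d → a * b * c + a * d ≡ a * (b * c + d)
  lemma = solve-∀

*ₛ-assoc : ∀ f g h → (f *ₛ g) *ₛ h ≈ₛ f *ₛ (g *ₛ h)
*ₛ-assoc f g h zero    = lemma (f 0) (g 0) (h 0)
  where
  lemma : ∀ a b c → (a * b + 0ℤ) * c + 0ℤ ≡ a * (b * c + 0ℤ) + 0ℤ
  lemma = solve-∀
*ₛ-assoc f g h (suc n) = begin
  (f 0 * g 0 + 0ℤ) * h (suc n) + (((f 0 · tail g) +ₛ (tail f *ₛ g)) *ₛ h) n
    ≡⟨ cong (λ z → (f 0 * g 0 + 0ℤ) * h (suc n) + z) (*ₛ-distribʳ h (f 0 · tail g) (tail f *ₛ g) n) ⟩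
  (f 0 * g 0 + 0ℤ) * h (suc n) + (((f 0 · tail g) *ₛ h) n + ((tail f *ₛ g) *ₛ h) n)
    ≡⟨ cong₂ (λ y z → (f 0 * g 0 + 0ℤ) * h (suc n) + (y + z))
         (·-*ₛ (f 0) (tail g) h n) (*ₛ-assoc (tail f) g h n) ⟩
  (f 0 * g 0 + 0ℤ) * h (suc n) + (f 0 * (tail g *ₛ h) n + (tail f *ₛ (g *ₛ h)) n)
    ≡⟨ lemma (f 0) (g 0) (h (suc n)) ((tail g *ₛ h) n) ((tail f *ₛ (g *ₛ h)) n) ⟩
  f 0 * (g 0 * h (suc n) + (tail g *ₛ h) n) + (tail f *ₛ (g *ₛ h)) n ∎
  where
  open ≡-Reasoning
  lemma : ∀ a b c d e → (a * b + 0ℤ) * c + (a * d + e) ≡ a * (b * c + d) + e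
  lemma = solve-∀

-- Splits off the last summand, where the definition splits off the first; commutativity follows by
-- playing the two against each other.
*ₛ-tailʳ : ∀ f g n → (f *ₛ g) (suc n) ≡ (f *ₛ tail g) n + f (suc n) * g 0
*ₛ-tailʳ f g zero    = lemma (f 0) (f 1) (g 0) (g 1)
  where
  lemma : ∀ a b c d → a * d + (b * c + 0ℤ) ≡ (a * d + 0ℤ) + b * c
  lemma = solve-∀
*ₛ-tailʳ f g (suc n) =
  trans (cong (λ z → f 0 * g (suc (suc n)) + z) (*ₛ-tailʳ (tail f) g n))
        (sym (ℤ.+-assoc (f 0 * g (suc (suc n))) _ _))

*ₛ-comm : ∀ f g → f *ₛ g ≈ₛ g *ₛ f
*ₛ-comm f g zero    = cong (_+ 0ℤ) (ℤ.*-comm (f 0) (g 0))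
*ₛ-comm f g (suc n) = begin
  f 0 * g (suc n) + (tail f *ₛ g) n ≡⟨ ℤ.+-comm (f 0 * g (suc n)) _ ⟩
  (tail f *ₛ g) n + f 0 * g (suc n) ≡⟨ cong₂ _+_ (*ₛ-comm (tail f) g n) (ℤ.*-comm (f 0) (g (suc n))) ⟩
  (g *ₛ tail f) n + g (suc n) * f 0 ≡⟨ *ₛ-tailʳ g f n ⟨
  (g *ₛ f) (suc n)                  ∎
  where open ≡-Reasoning

zero-*ₛ : ∀ f {g} → (∀ n → g n ≡ 0ℤ) → ∀ n → (g *ₛ f) n ≡ 0ℤ
zero-*ₛ f p zero    rewrite p 0 = refl
zero-*ₛ f p (suc n) rewrite p 0 = trans (ℤ.+-identityˡ _) (zero-*ₛ f (λ k → p (suc k)) n)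

const-*ₛ : ∀ c f → const c *ₛ f ≈ₛ c · f
const-*ₛ c f zero    = ℤ.+-identityʳ (c * f 0)
const-*ₛ c f (suc n) =
  trans (cong (λ z → c * f (suc n) + z) (zero-*ₛ f (λ _ → refl) n)) (ℤ.+-identityʳ (c * f (suc n)))

x-*ₛ : ∀ f → x *ₛ f ≈ₛ shift 1 f
x-*ₛ f zero          = refl
x-*ₛ f (suc n) = trans (ℤ.+-identityˡ _) (trans (tail-x n) (ℤ.*-identityˡ (f n)))
  where
  tail-x : ∀ n → (tail x *ₛ f) n ≡ 1ℤ * f n
  tail-x n = trans (*ₛ-congʳ f {tail x} {1ₛ} (λ { zero → refl ; (suc _) → refl }) n) (const-*ₛ 1ℤ f n)

x^-*ₛ : ∀ k f → x ^ₛ k *ₛ f ≈ₛ shift k f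
x^-*ₛ zero    f n = trans (const-*ₛ 1ℤ f n) (ℤ.*-identityˡ (f n))
x^-*ₛ (suc k) f n =
  trans (*ₛ-assoc x (x ^ₛ k) f n) (trans (x-*ₛ (x ^ₛ k *ₛ f) n) (step n))
  where
  step : shift 1 (x ^ₛ k *ₛ f) ≈ₛ shift (suc k) f
  step zero    = refl
  step (suc n) = x^-*ₛ k f n

*ₛ-1ₛ : ∀ f → f *ₛ 1ₛ ≈ₛ f
*ₛ-1ₛ f n = trans (*ₛ-comm f 1ₛ n) (trans (const-*ₛ 1ℤ f n) (ℤ.*-identityˡ (f n)))

*ₛ-1-x^ : ∀ k f → f *ₛ (const (+ 1) -ₛ x ^ₛ k) ≈ₛ Δ k f
*ₛ-1-x^ k f n = begin
  (f *ₛ (1ₛ -ₛ x ^ₛ k)) n                 ≡⟨ *ₛ-comm f (1ₛ -ₛ x ^ₛ k) n ⟩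
  ((1ₛ -ₛ x ^ₛ k) *ₛ f) n                 ≡⟨ *ₛ-congʳ f {1ₛ -ₛ x ^ₛ k} {1ₛ +ₛ (- 1ℤ) · x ^ₛ k}
                                                (λ m → cong (λ z → 1ₛ m + z) (sym (ℤ.-1*i≡-i ((x ^ₛ k) m)))) n ⟩
  ((1ₛ +ₛ (- 1ℤ) · x ^ₛ k) *ₛ f) n        ≡⟨ *ₛ-distribʳ f 1ₛ ((- 1ℤ) · x ^ₛ k) n ⟩
  (1ₛ *ₛ f) n + (((- 1ℤ) · x ^ₛ k) *ₛ f) n ≡⟨ cong₂ _+_ (x^-*ₛ 0 f n) (·-*ₛ (- 1ℤ) (x ^ₛ k) f n) ⟩
  f n + - 1ℤ * (x ^ₛ k *ₛ f) n            ≡⟨ cong (λ z → f n + - 1ℤ * z) (x^-*ₛ k f n) ⟩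
  f n + - 1ℤ * shift k f n                ≡⟨ cong (λ z → f n + z) (ℤ.-1*i≡-i (shift k f n)) ⟩
  Δ k f n                                 ∎
  where open ≡-Reasoning

-- Long division of `q *ₛ g` by `g` returns `q` one coefficient at a time. Equalities of quotients
-- thus reduce to equalities of products.
divide-unique : ∀ {q f g} → g 0 ≡ 1ℤ → q *ₛ g ≈ₛ f → q ≈ₛ divide f g
divide-unique {q} {f} {g} g₀ p n = trans (lemma n q) (divide-cong n {q *ₛ g} p)
  where
  divide-cong : ∀ n {f f′} → f ≈ₛ f′ → divide f g n ≡ divide f′ g n
  divide-cong zero    p = p 0
  divide-cong (suc n) p = divide-cong n λ k → cong₂ (λ y z → y - z * g (suc k)) (p (suc k)) (p 0)

  cancel : ∀ a b c → b ≡ (a * c + b) - (a * 1ℤ + 0ℤ) * c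
  cancel = solve-∀

  lemma : ∀ n q → q n ≡ divide (q *ₛ g) g n
  lemma zero    q = sym (trans (ℤ.+-identityʳ _) (trans (cong (q 0 *_) g₀) (ℤ.*-identityʳ (q 0))))
  -- The dividend left after one step of division is `tail q *ₛ g`, so the induction continues with
  -- `tail q`. The factor `q 0 * z + 0ℤ` is the constant term of `q *ₛ g`.
  lemma (suc n) q = trans (lemma n (tail q)) (divide-cong n λ k →
    trans (cancel (q 0) ((tail q *ₛ g) k) (g (suc k)))
          (cong (λ z → (q 0 * g (suc k) + (tail q *ₛ g) k) - (q 0 * z + 0ℤ) * g (suc k)) (sym g₀)))

-- The numerator and the denominator as operators on series

numerator denominator : Series
numerator   = const (+ 8) *ₛ x ^ₛ 10 *ₛ (const (+ 2) *ₛ x ^ₛ 2 +ₛ const (+ 1))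
denominator = (const (+ 1) -ₛ x) ^ₛ 2 *ₛ (const (+ 1) -ₛ x ^ₛ 4) *ₛ (const (+ 1) -ₛ x ^ₛ 6)

*ₛ-1-x : ∀ f → f *ₛ (const (+ 1) -ₛ x) ≈ₛ Δ 1 f
*ₛ-1-x f n = trans (*ₛ-congˡ f (λ m → cong (λ z → 1ₛ m - z) (sym (*ₛ-1ₛ x m))) n) (*ₛ-1-x^ 1 f n)

*ₛ-denominator : ∀ f → f *ₛ denominator ≈ₛ Δ 6 (Δ 4 (Δ 1 (Δ 1 f)))
*ₛ-denominator f =
  ≈-trans (≈-sym (*ₛ-assoc f (u *ₛ (u *ₛ 1ₛ) *ₛ (1ₛ -ₛ x ^ₛ 4)) (1ₛ -ₛ x ^ₛ 6)))
  (≈-trans (*ₛ-1-x^ 6 (f *ₛ (u *ₛ (u *ₛ 1ₛ) *ₛ (1ₛ -ₛ x ^ₛ 4)))) (Δ-cong 6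
  (≈-trans (≈-sym (*ₛ-assoc f (u *ₛ (u *ₛ 1ₛ)) (1ₛ -ₛ x ^ₛ 4)))
  (≈-trans (*ₛ-1-x^ 4 (f *ₛ (u *ₛ (u *ₛ 1ₛ)))) (Δ-cong 4
  (≈-trans (*ₛ-congˡ f (*ₛ-congˡ u (*ₛ-1ₛ u)))
  (≈-trans (≈-sym (*ₛ-assoc f u u))
  (≈-trans (*ₛ-1-x (f *ₛ u)) (Δ-cong 1 (*ₛ-1-x f))))))))))
  where
  u : Series
  u = const (+ 1) -ₛ x

numerator-*ₛ : ∀ f n → (numerator *ₛ f) n ≡ + 8 * (+ 2 * shift 12 f n + shift 10 f n)
numerator-*ₛ f n = begin
  (numerator *ₛ f) n                    ≡⟨ *ₛ-assoc (const (+ 8) *ₛ x ^ₛ 10) s f n ⟩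
  (const (+ 8) *ₛ x ^ₛ 10 *ₛ (s *ₛ f)) n ≡⟨ *ₛ-assoc (const (+ 8)) (x ^ₛ 10) (s *ₛ f) n ⟩
  (const (+ 8) *ₛ (x ^ₛ 10 *ₛ (s *ₛ f))) n ≡⟨ const-*ₛ (+ 8) (x ^ₛ 10 *ₛ (s *ₛ f)) n ⟩
  + 8 * (x ^ₛ 10 *ₛ (s *ₛ f)) n         ≡⟨ cong (+ 8 *_) (x^-*ₛ 10 (s *ₛ f) n) ⟩
  + 8 * shift 10 (s *ₛ f) n             ≡⟨ cong (+ 8 *_) (shift-cong 10 s-*ₛ n) ⟩
  + 8 * shift 10 (λ m → + 2 * shift 2 f m + f m) n ≡⟨ cong (+ 8 *_) (shift-linear 10 (+ 2) (shift 2 f) f n) ⟩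
  + 8 * (+ 2 * shift 10 (shift 2 f) n + shift 10 f n) ≡⟨ cong (λ z → + 8 * (+ 2 * z + shift 10 f n)) (shift-shift 10 2 f n) ⟩
  + 8 * (+ 2 * shift 12 f n + shift 10 f n) ∎
  where
  open ≡-Reasoning
  s : Series
  s = const (+ 2) *ₛ x ^ₛ 2 +ₛ const (+ 1)
  s-*ₛ : s *ₛ f ≈ₛ λ m → + 2 * shift 2 f m + f m
  s-*ₛ m = trans (*ₛ-distribʳ f (const (+ 2) *ₛ x ^ₛ 2) (const (+ 1)) m)
    (cong₂ _+_ (trans (*ₛ-assoc (const (+ 2)) (x ^ₛ 2) f m)
                 (trans (const-*ₛ (+ 2) (x ^ₛ 2 *ₛ f) m) (cong (+ 2 *_) (x^-*ₛ 2 f m))))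
               (x^-*ₛ 0 f m))

-- The closed form

-- The recursive clauses make period 12 hold by reduction alone, for symbolic arguments too.
linearCoeff constantCoeff : ℕ → ℤ
linearCoeff 0             = + 76
linearCoeff 1             = + 73
linearCoeff (suc (suc t)) = linearCoeff t

constantCoeff 0  = + 96
constantCoeff 1  = + 58
constantCoeff 2  = + 96
constantCoeff 3  = + 102
constantCoeff 4  = + 112
constantCoeff 5  = + 90
constantCoeff 6  = + 96
constantCoeff 7  = + 70
constantCoeff 8  = + 96
constantCoeff 9  = + 90
constantCoeff 10 = + 112
constantCoeff 11 = + 102
constantCoeff (suc (suc (suc (suc (suc (suc (suc (suc (suc (suc (suc (suc t)))))))))))) = constantCoeff t

cubic : ℤ → ℤ → ℤ → ℤ
cubic a b t = t ^ 3 - + 16 * t ^ 2 + a * t - b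

closedForm : ℕ → ℤ
closedForm t = cubic (linearCoeff t) (constantCoeff t) (+ t)

-- The closed form is wrong at t = 0, where it gives −96 instead of 0.
closedSeries : Series
closedSeries zero    = 0ℤ
closedSeries (suc n) = closedForm (suc n)

-- The product of the four factors vanishes to order 4 at 1 and to order 2 at -1, which kills cubics
-- and linear terms alternating with parity; `(1-x^4)(1-x^6)` alone kills the periodic constants.
-- Keeping the index `s` of the coefficients apart from the value `t` leaves one polynomial identity
-- in `t` for each residue of `s` modulo 12.
Δ-closedForm : ∀ s t →
  Δ 6 (Δ 4 (Δ 1 (Δ 1 λ i → cubic (linearCoeff (i ℕ.+ s)) (constantCoeff (i ℕ.+ s)) (+ i + t)))) 12 ≡ 0ℤ
Δ-closedForm = go
  where
  cubicₚ : ℤ → ℤ → Polynomial 1 → Polynomial 1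
  cubicₚ a b t = t :* (t :* (t :* con 1ℤ)) :- con (+ 16) :* (t :* (t :* con 1ℤ)) :+ con a :* t :- con b

  Δₚ : ℕ → Polynomial 1 → Polynomial 1
  -- `Δ 6 (Δ 4 _)` at 12 involves the second differences at 12, 8, 6 and 2 only.
  Δₚ s t = (d 12 :- d 8) :- (d 6 :- d 2)
    where
    h d : ℕ → Polynomial 1
    h i = cubicₚ (linearCoeff (i ℕ.+ s)) (constantCoeff (i ℕ.+ s)) (con (+ i) :+ t)
    d i = (h i :- h (i ℕ.∸ 1)) :- (h (i ℕ.∸ 1) :- h (i ℕ.∸ 2))

  go : ∀ s t → _ ≡ 0ℤ
  go 0  = solve 1 (λ t → Δₚ 0  t := con 0ℤ) refl
  go 1  = solve 1 (λ t → Δₚ 1  t := con 0ℤ) refl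
  go 2  = solve 1 (λ t → Δₚ 2  t := con 0ℤ) refl
  go 3  = solve 1 (λ t → Δₚ 3  t := con 0ℤ) refl
  go 4  = solve 1 (λ t → Δₚ 4  t := con 0ℤ) refl
  go 5  = solve 1 (λ t → Δₚ 5  t := con 0ℤ) refl
  go 6  = solve 1 (λ t → Δₚ 6  t := con 0ℤ) refl
  go 7  = solve 1 (λ t → Δₚ 7  t := con 0ℤ) refl
  go 8  = solve 1 (λ t → Δₚ 8  t := con 0ℤ) refl
  go 9  = solve 1 (λ t → Δₚ 9  t := con 0ℤ) refl
  go 10 = solve 1 (λ t → Δₚ 10 t := con 0ℤ) refl
  go 11 = solve 1 (λ t → Δₚ 11 t := con 0ℤ) refl
  go (suc (suc (suc (suc (suc (suc (suc (suc (suc (suc (suc (suc s)))))))))))) = go s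

closedSeries-*ₛ : closedSeries *ₛ denominator ≈ₛ + 6 · numerator
closedSeries-*ₛ n = begin
  (closedSeries *ₛ denominator) n               ≡⟨ *ₛ-denominator closedSeries n ⟩
  Δ 6 (Δ 4 (Δ 1 (Δ 1 closedSeries))) n          ≡⟨ coefficients n ⟩
  + 6 * (+ 8 * (+ 2 * shift 12 1ₛ n + shift 10 1ₛ n)) ≡⟨ cong (+ 6 *_) (numerator-*ₛ 1ₛ n) ⟨
  + 6 * (numerator *ₛ 1ₛ) n                     ≡⟨ cong (+ 6 *_) (*ₛ-1ₛ numerator n) ⟩
  + 6 * numerator n                             ∎
  where
  open ≡-Reasoning
  coefficients : ∀ n → Δ 6 (Δ 4 (Δ 1 (Δ 1 closedSeries))) n ≡
                       + 6 * (+ 8 * (+ 2 * shift 12 1ₛ n + shift 10 1ₛ n))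
  coefficients 0  = refl
  coefficients 1  = refl
  coefficients 2  = refl
  coefficients 3  = refl
  coefficients 4  = refl
  coefficients 5  = refl
  coefficients 6  = refl
  coefficients 7  = refl
  coefficients 8  = refl
  coefficients 9  = refl
  coefficients 10 = refl
  coefficients 11 = refl
  coefficients 12 = refl
  -- The operator looks back 12 places. From index 13 on it therefore never meets the exceptional
  -- value at 0, and the right-hand side vanishes.
  coefficients (suc (suc (suc (suc (suc (suc (suc (suc (suc (suc (suc (suc (suc n))))))))))))) =
    Δ-closedForm (suc n) (+ suc n)

-- `+ 6 · f` and `closedSeries` are both the quotient of `+ 6 · numerator` by `denominator`. Indices
-- start at 1 because `closedSeries` departs from `closedForm` at 0.
6·-closed : ∀ {f} → f *ₛ denominator ≈ₛ numerator → ∀ t → + 6 * f (suc t) ≡ closedForm (suc t)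
6·-closed {f} p t = trans
  (divide-unique {+ 6 · f} {+ 6 · numerator} {denominator} refl
    (λ n → trans (·-*ₛ (+ 6) f denominator n) (cong (+ 6 *_) (p n))) (suc t))
  (sym (divide-unique {closedSeries} {+ 6 · numerator} {denominator} refl closedSeries-*ₛ (suc t)))

periodic-% : ∀ {A : Set} (f : ℕ → A) → (∀ t → f (12 ℕ.+ t) ≡ f t) → ∀ t → f t ≡ f (t % 12)
periodic-% f periodic t =
  trans (cong f (trans (m≡m%n+[m/n]*n t 12) (ℕ.+-comm (t % 12) _))) (multiple (t ℕ./ 12))
  where
  multiple : ∀ k {r} → f (k ℕ.* 12 ℕ.+ r) ≡ f r
  multiple zero    = refl
  multiple (suc k) = trans (periodic _) (multiple k)

closedForm-% : ∀ t {r} → t % 12 ≡ r → closedForm t ≡ cubic (linearCoeff r) (constantCoeff r) (+ t)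
closedForm-% t refl = cong₂ (λ a b → cubic a b (+ t))
  (periodic-% linearCoeff (λ _ → refl) t) (periodic-% constantCoeff (λ _ → refl) t)

6*≡⇒≡/6 : ∀ {m n} → + 6 * m ≡ n → m / 1 ≡ n / 6
-- `mkℚᵘ` stores the denominator minus one: 0 and 5 stand for the denominators 1 and 6.
6*≡⇒≡/6 {m} refl = ℚ.fromℚᵘ-cong {mkℚᵘ m 0} {mkℚᵘ (+ 6 * m) 5}
  (*≡* (trans (ℤ.*-comm m (+ 6)) (sym (ℤ.*-identityʳ (+ 6 * m)))))

-- Counting

-- Elements are counted, not proofs of `P`, so `P` may be proof-relevant. The size lives in ℤ to be
-- compared with coefficients of series.
record Count {A : Set} (P : A → Set) (z : ℤ) : Set where
  field
    elements : List A
    unique   : Unique elements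
    member   : ∀ a → a ∈ elements ⇔ P a
    size     : + length elements ≡ z

open Count

count-unique : ∀ {A} {P : A → Set} {y z} → Count P y → Count P z → y ≡ z
count-unique c d = trans (sym (size c)) (trans (cong +_ (↭-length (∼bag⇒↭
  (unique∧set⇒bag (unique c) (unique d) λ {a} → Comp.equivalence (member c a) (Sym.equivalence (member d a))))))
  (size d))

count-⊥ : ∀ {A} {P : A → Set} → (∀ a → ¬ P a) → Count P 0ℤ
count-⊥ ¬P .elements = []
count-⊥ ¬P .unique   = []
count-⊥ ¬P .member a = mk⇔ (λ ()) (λ p → contradiction p (¬P a))
count-⊥ ¬P .size     = refl

count-singleton : ∀ {A} {P : A → Set} {a} → P a → (∀ b → P b → b ≡ a) → Count P 1ℤ
count-singleton {a = a} p only .elements = [ a ]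
count-singleton p only .unique   = [] ∷ []
count-singleton p only .member b = mk⇔ (λ { (here refl) → p }) (here ∘ only b)
count-singleton p only .size     = refl

-- Injectivity is asked on `P` only: `squareOf`, for instance, forgets a parameter that validity
-- restores.
count-image : ∀ {A B} {P : A → Set} {Q : B → Set} {z} (f : A → B) →
              (∀ {a b} → P a → P b → f a ≡ f b → a ≡ b) →
              (∀ a → P a → Q (f a)) → (∀ b → Q b → ∃ λ a → P a × b ≡ f a) → Count P z → Count Q z
count-image f inj to from c .elements = map f (elements c)
count-image {P = P} f inj to from c .unique =
  unique-map (All.tabulate λ {a} → Equivalence.to (member c a)) (unique c)
  where
  unique-map : ∀ {as} → All P as → Unique as → Unique (map f as)
  unique-map []       []       = []
  unique-map (p ∷ ps) (a∉ ∷ u) =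
    All.map⁺ (All.zipWith (λ (p′ , a≢) → a≢ ∘ inj p p′) (ps , a∉)) ∷ unique-map ps u
count-image {Q = Q} f inj to from c .member b = mk⇔
  (λ b∈ → let (a , a∈ , b≡) = ∈-map⁻ f b∈ in subst Q (sym b≡) (to a (Equivalence.to (member c a) a∈)))
  (λ q → let (a , p , b≡) = from b q in subst (_∈ _) (sym b≡) (∈-map⁺ f (Equivalence.from (member c a) p)))
count-image f inj to from c .size     = trans (cong +_ (length-map f (elements c))) (size c)

count-∃ : ∀ {A B} {P : A → Set} {z} (f : A → B) → Injective _≡_ _≡_ f →
          Count P z → Count (λ b → ∃ λ a → P a × b ≡ f a) z
count-∃ f inj = count-image f (λ _ _ → inj) (λ a p → a , p , refl) (λ _ → id)

count-⇔ : ∀ {A} {P Q : A → Set} {z} → (∀ a → P a → Q a) → (∀ a → Q a → P a) → Count P z → Count Q z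
count-⇔ to from = count-image id (λ _ _ → id) to (λ a q → a , from a q , refl)

count-⊎ : ∀ {A} {P Q : A → Set} {y z} → (∀ a → P a → ¬ Q a) →
          Count P y → Count Q z → Count (λ a → P a ⊎ Q a) (y + z)
count-⊎ disjoint c d .elements = elements c ++ elements d
count-⊎ disjoint c d .unique   = Unique.++⁺ (unique c) (unique d)
  λ {a} (a∈ , a∈′) → disjoint a (Equivalence.to (member c a) a∈) (Equivalence.to (member d a) a∈′)
count-⊎ disjoint c d .member a = mk⇔
  ([ inj₁ ∘ Equivalence.to (member c a) , inj₂ ∘ Equivalence.to (member d a) ]′ ∘ ∈-++⁻ (elements c))
  [ ∈-++⁺ˡ ∘ Equivalence.from (member c a) , ∈-++⁺ʳ (elements c) ∘ Equivalence.from (member d a) ]′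
count-⊎ disjoint c d .size = trans (cong +_ (length-++ (elements c))) (cong₂ _+_ (size c) (size d))

-- `σ` carries the half of `P` where `R` holds bijectively onto the other half.
count-involution : ∀ {A} {P R : A → Set} {z} (σ : A → A) → (∀ a → σ (σ a) ≡ a) →
                   (∀ a → P a → P (σ a)) → (∀ a → P a → R a ⊎ R (σ a)) → (∀ a → R a → ¬ R (σ a)) →
                   Count (λ a → P a × R a) z → Count P (z + z)
count-involution {P = P} {R} σ σσ P-σ total exclusive c = count-⇔
  (λ a → [ proj₁ , (λ (p , _) → subst P (σσ a) (P-σ (σ a) p)) ]′)
  (λ a p → [ (λ r → inj₁ (p , r)) , (λ r → inj₂ (P-σ a p , r)) ]′ (total a p))
  (count-⊎ (λ a (_ , r) (_ , r′) → exclusive a r r′) c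
    (count-image σ (λ {a} {b} _ _ eq → trans (sym (σσ a)) (trans (cong σ eq) (σσ b)))
      (λ a → subst (λ b → P b × R b) (sym (σσ a))) (λ a pr → σ a , pr , sym (σσ a)) c))

count-shift : ∀ {A} (μ : A → ℕ) {f} → (∀ n → Count (λ a → μ a ≡ n) (f n)) →
              ∀ k n → Count (λ a → k ℕ.+ μ a ≡ n) (shift k f n)
count-shift μ c zero    n       = c n
count-shift μ c (suc k) zero    = count-⊥ λ _ ()
count-shift μ c (suc k) (suc n) = count-⇔ (λ _ → cong suc) (λ _ → ℕ.suc-injective) (count-shift μ c k n)

-- Solutions of weighted linear equations

Σ[_·_] : ∀ {k} → Vec ℕ k → Vec ℕ k → ℕ
Σ[ []     · []     ] = 0
Σ[ w ∷ ws · v ∷ vs ] = v ℕ.* w ℕ.+ Σ[ ws · vs ]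

-- Multiplying the generating function of the solutions by 1/(1-x^w) adds a variable of weight w.
count-solutions-∷ : ∀ {k} {ws : Vec ℕ k} {f g} w → 0 ℕ.< w → f ≈ₛ Δ w g →
                    (∀ n → Count (λ vs → Σ[ ws · vs ] ≡ n) (f n)) →
                    ∀ n → Count (λ vs → Σ[ w ∷ ws · vs ] ≡ n) (g n)
count-solutions-∷ {ws = ws} {f} {g} w w>0 f≈Δg c = <-rec _ λ n rec →
  -- `f n` counts the solutions whose new variable is 0. Lowering a positive new variable by 1 takes
  -- `w` off the total, which is a strict decrease since `w` is positive, so the recursion supplies
  -- `shift w g n`.
  subst (Count _) (trans (cong (_+ shift w g n) (f≈Δg n)) (cancel n))
    (count-⇔ (split n) (unsplit n) (count-⊎ (disjoint n) (zeros n) (sucs n rec)))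
  where
  Zero Suc : ℕ → Vec ℕ _ → Set
  Zero n (v ∷ vs) = v ≡ 0 × Σ[ ws · vs ] ≡ n
  Suc  n (v ∷ vs) = ∃ λ u → v ≡ suc u × w ℕ.+ Σ[ w ∷ ws · u ∷ vs ] ≡ n

  cancel : ∀ n → g n - shift w g n + shift w g n ≡ g n
  cancel n = trans (ℤ.+-assoc (g n) _ _) (trans (cong (λ z → g n + z) (ℤ.+-inverseˡ (shift w g n))) (ℤ.+-identityʳ (g n)))

  disjoint : ∀ n vs → Zero n vs → ¬ Suc n vs
  disjoint n (_ ∷ _) (refl , _) (_ , () , _)

  split : ∀ n vs → Zero n vs ⊎ Suc n vs → Σ[ w ∷ ws · vs ] ≡ n
  split n (_ ∷ vs) (inj₁ (refl , eq))     = eq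
  split n (_ ∷ vs) (inj₂ (u , refl , eq)) = trans (ℕ.+-assoc w (u ℕ.* w) _) eq

  unsplit : ∀ n vs → Σ[ w ∷ ws · vs ] ≡ n → Zero n vs ⊎ Suc n vs
  unsplit n (zero  ∷ vs) eq = inj₁ (refl , eq)
  unsplit n (suc u ∷ vs) eq = inj₂ (u , refl , trans (sym (ℕ.+-assoc w (u ℕ.* w) _)) eq)

  zeros : ∀ n → Count (Zero n) (f n)
  zeros n = count-image (0 ∷_) (λ { _ _ refl → refl }) (λ _ eq → refl , eq)
    (λ { (_ ∷ vs) (refl , eq) → vs , eq , refl }) (c n)

  sucs : ∀ n → (∀ {m} → m ℕ.< n → Count (λ vs → Σ[ w ∷ ws · vs ] ≡ m) (g m)) → Count (Suc n) (shift w g n)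
  sucs n rec with w ℕ.≤? n
  ... | no  w≰n = subst (Count _) (sym (shift-< w g (ℕ.≰⇒> w≰n)))
    (count-⊥ λ { (_ ∷ _) (_ , _ , eq) → w≰n (ℕ.m+n≤o⇒m≤o w (ℕ.≤-reflexive eq)) })
  ... | yes w≤n with m , refl ← ℕ.m≤n⇒∃[o]m+o≡n w≤n = subst (Count _) (sym (shift-+ w g m))
    (count-image bump (λ _ _ → bump-injective)
      (λ { (v ∷ vs) eq → v , refl , cong (w ℕ.+_) eq })
      (λ { (_ ∷ vs) (u , refl , eq) → u ∷ vs , ℕ.+-cancelˡ-≡ w _ _ eq , refl })
      (rec (ℕ.m<n+m m w>0)))
    where
    bump : ∀ {k} → Vec ℕ (suc k) → Vec ℕ (suc k)
    bump (v ∷ vs) = suc v ∷ vs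
    bump-injective : ∀ {k} → Injective _≡_ _≡_ (bump {k})
    bump-injective {_} {_ ∷ _} {_ ∷ _} refl = refl

weights : Vec ℕ 4
weights = 1 ∷ 1 ∷ 4 ∷ 6 ∷ []

parts₆ parts₄₆ parts₁₄₆ parts₁₁₄₆ : Series
parts₆    = 1ₛ /ₛ (const (+ 1) -ₛ x ^ₛ 6)
parts₄₆   = parts₆ /ₛ (const (+ 1) -ₛ x ^ₛ 4)
parts₁₄₆  = parts₄₆ /ₛ (const (+ 1) -ₛ x ^ₛ 1)
parts₁₁₄₆ = parts₁₄₆ /ₛ (const (+ 1) -ₛ x ^ₛ 1)

Δ-/ₛ : ∀ k f {p} → Δ k (_/ₛ_ f (const (+ 1) -ₛ x ^ₛ k) {p}) ≈ₛ f
Δ-/ₛ k f {p} = ≈-trans (≈-sym (*ₛ-1-x^ k (_/ₛ_ f (const (+ 1) -ₛ x ^ₛ k) {p}))) (/ₛ-*ₛ f (const (+ 1) -ₛ x ^ₛ k) {p})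

-- The four differences undo the four divisions, the last division first.
parts-*ₛ-denominator : parts₁₁₄₆ *ₛ denominator ≈ₛ 1ₛ
parts-*ₛ-denominator =
  ≈-trans (*ₛ-denominator parts₁₁₄₆)
  (≈-trans (Δ-cong 6 (Δ-cong 4 (≈-trans (Δ-cong 1 (Δ-/ₛ 1 parts₁₄₆)) (Δ-/ₛ 1 parts₄₆))))
  (≈-trans (Δ-cong 6 (Δ-/ₛ 4 parts₆)) (Δ-/ₛ 6 1ₛ)))

count-solutions : ∀ n → Count (λ vs → Σ[ weights · vs ] ≡ n) (parts₁₁₄₆ n)
count-solutions =
  count-solutions-∷ 1 ℕ.z<s (≈-sym (Δ-/ₛ 1 parts₁₄₆))
  (count-solutions-∷ 1 ℕ.z<s (≈-sym (Δ-/ₛ 1 parts₄₆))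
  (count-solutions-∷ 4 ℕ.z<s (≈-sym (Δ-/ₛ 4 parts₆))
  (count-solutions-∷ 6 ℕ.z<s (≈-sym (Δ-/ₛ 6 1ₛ)) base)))
  where
  base : ∀ n → Count (λ vs → Σ[ [] · vs ] ≡ n) (1ₛ n)
  base zero    = count-singleton {a = []} refl λ { [] _ → refl }
  base (suc n) = count-⊥ λ { [] () }

-- Symmetries of the square

matrix : (Fin 3 → Fin 3 → ℕ) → Matrix
matrix f = tabulate λ i → tabulate (f i)

entry-matrix : ∀ f i j → entry (matrix f) i j ≡ f i j
entry-matrix f i j = trans (cong (λ row → Vec.lookup row j) (lookup∘tabulate (λ i → tabulate (f i)) i))
                           (lookup∘tabulate (f i) j)

-- `antitranspose` is the reflection in the antidiagonal. As a conjugate of `transpose` it inherits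
-- the preservation of magic squares.
transpose reflect antitranspose : Matrix → Matrix
transpose A     = matrix λ i j → entry A j i
reflect A       = matrix λ i j → entry A i (opposite j)
antitranspose A = reflect (transpose (reflect A))

entry-transpose : ∀ A i j → entry (transpose A) i j ≡ entry A j i
entry-transpose A = entry-matrix λ i j → entry A j i

entry-reflect : ∀ A i j → entry (reflect A) i j ≡ entry A i (opposite j)
entry-reflect A = entry-matrix λ i j → entry A i (opposite j)

transpose-involutive : ∀ A → transpose (transpose A) ≡ A
transpose-involutive ((_ ∷ _ ∷ _ ∷ []) ∷ (_ ∷ _ ∷ _ ∷ []) ∷ (_ ∷ _ ∷ _ ∷ []) ∷ []) = refl

reflect-involutive : ∀ A → reflect (reflect A) ≡ A
reflect-involutive ((_ ∷ _ ∷ _ ∷ []) ∷ (_ ∷ _ ∷ _ ∷ []) ∷ (_ ∷ _ ∷ _ ∷ []) ∷ []) = refl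

antitranspose-involutive : ∀ A → antitranspose (antitranspose A) ≡ A
antitranspose-involutive ((_ ∷ _ ∷ _ ∷ []) ∷ (_ ∷ _ ∷ _ ∷ []) ∷ (_ ∷ _ ∷ _ ∷ []) ∷ []) = refl

reverse₃ : ∀ a b c → a ℕ.+ (b ℕ.+ (c ℕ.+ 0)) ≡ c ℕ.+ (b ℕ.+ (a ℕ.+ 0))
reverse₃ = ℕ-Solver.solve-∀

module _ {t : ℕ} {A : Matrix} (below : MagicBelow t A) where
  private
    bounds : EntriesStrictlyBetween 0 t A
    bounds = proj₂ below

  open IsMagic (proj₁ below)

  transpose-magicBelow : MagicBelow t (transpose A)
  transpose-magicBelow = record
    { positive     = λ i j → proj₁ (bounds′ i j)
    ; distinct     = λ i j k l eq → swap (distinct j i l k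
        (trans (sym (entry-transpose A i j)) (trans eq (entry-transpose A k l))))
    ; magicSum     = magicSum
    -- At a literal index, a row sum of the transpose reduces to a column sum of `A`, so the old
    -- equation fits as it stands.
    ; rows         = λ { 0F → columns 0F ; 1F → columns 1F ; 2F → columns 2F }
    ; columns      = λ { 0F → rows 0F ; 1F → rows 1F ; 2F → rows 2F }
    ; diagonal     = diagonal
    ; antidiagonal = trans (reverse₃ (entry A 2F 0F) (entry A 1F 1F) (entry A 0F 2F)) antidiagonal
    } , bounds′
    where
    bounds′ : EntriesStrictlyBetween 0 t (transpose A)
    bounds′ i j = subst (λ e → 0 ℕ.< e × e ℕ.< t) (sym (entry-transpose A i j)) (bounds j i)

  reflect-magicBelow : MagicBelow t (reflect A)
  reflect-magicBelow = record
    { positive     = λ i j → proj₁ (bounds′ i j)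
    ; distinct     = λ i j k l eq →
        let (i≡k , j≡l) = distinct i (opposite j) k (opposite l)
              (trans (sym (entry-reflect A i j)) (trans eq (entry-reflect A k l)))
        in i≡k , trans (sym (Fin.opposite-involutive j)) (trans (cong opposite j≡l) (Fin.opposite-involutive l))
    ; magicSum     = magicSum
    ; rows         = λ { 0F → reversed-row 0F ; 1F → reversed-row 1F ; 2F → reversed-row 2F }
    ; columns      = λ { 0F → columns 2F ; 1F → columns 1F ; 2F → columns 0F }
    ; diagonal     = antidiagonal
    ; antidiagonal = diagonal
    } , bounds′
    where
    bounds′ : EntriesStrictlyBetween 0 t (reflect A)
    bounds′ i j = subst (λ e → 0 ℕ.< e × e ℕ.< t) (sym (entry-reflect A i j)) (bounds i (opposite j))
    reversed-row : ∀ i → entry A i 2F ℕ.+ (entry A i 1F ℕ.+ (entry A i 0F ℕ.+ 0)) ≡ magicSum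
    reversed-row i = trans (reverse₃ (entry A i 2F) (entry A i 1F) (entry A i 0F)) (rows i)

antitranspose-magicBelow : ∀ {t A} → MagicBelow t A → MagicBelow t (antitranspose A)
antitranspose-magicBelow = reflect-magicBelow ∘ transpose-magicBelow ∘ reflect-magicBelow

Descends : (i j k l : Fin 3) → Matrix → Set
Descends i j k l A = entry A k l ℕ.< entry A i j

descends-total : ∀ {t A} → MagicBelow t A → ∀ i j k l → ¬ (i ≡ k × j ≡ l) →
                 Descends i j k l A ⊎ Descends k l i j A
descends-total {A = A} (m , _) i j k l ≢ with ℕ.<-cmp (entry A k l) (entry A i j)
... | tri< lt _ _ = inj₁ lt
... | tri≈ _ eq _ = contradiction (IsMagic.distinct m i j k l (sym eq)) ≢
... | tri> _ _ gt = inj₂ gt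

-- The corner inequalities select one square from each orbit of the dihedral group.
Canonical : ℕ → Matrix → Set
Canonical t A = ((MagicBelow t A × Descends 0F 0F 2F 2F A) × Descends 0F 2F 2F 0F A) × Descends 0F 0F 0F 2F A

-- Each involution reverses one corner inequality and respects those imposed before it:
-- `antitranspose` swaps the corners on the main diagonal, `transpose` fixes them and swaps the
-- other two, and `reflect` exchanges the two diagonal inequalities.
count-magicBelow : ∀ {t c} → Count (Canonical t) c → Count (MagicBelow t) (((c + c) + (c + c)) + ((c + c) + (c + c)))
count-magicBelow =
    count-involution antitranspose antitranspose-involutive (λ _ → antitranspose-magicBelow)
      (λ _ m → descends-total m 0F 0F 2F 2F λ ()) (λ _ → ℕ.<-asym)
  ∘ count-involution transpose transpose-involutive (λ _ (m , d) → transpose-magicBelow m , d)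
      (λ _ (m , _) → descends-total m 0F 2F 2F 0F λ ()) (λ _ → ℕ.<-asym)
  ∘ count-involution reflect reflect-involutive (λ _ ((m , d) , e) → (reflect-magicBelow m , e) , d)
      (λ _ ((m , _) , _) → descends-total m 0F 0F 0F 2F λ ()) (λ _ → ℕ.<-asym)

-- Parametrisation of the canonical squares

-- Every entry is the least entry plus iα + jβ, each (i , j) ∈ {0,1,2}² occurring once.
coeffα coeffβ : Fin 3 → Fin 3 → Fin 3
coeffα 0F 0F = 2F
coeffα 0F 1F = 0F
coeffα 0F 2F = 1F
coeffα 1F 0F = 0F
coeffα 1F 1F = 1F
coeffα 1F 2F = 2F
coeffα 2F 0F = 1F
coeffα 2F 1F = 2F
coeffα 2F 2F = 0F
coeffβ i j = coeffα i (opposite j)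

-- The two arrays are orthogonal Latin squares, which evaluation over all index quadruples confirms.
coeff-injective : ∀ i j k l → coeffα i j ≡ coeffα k l → coeffβ i j ≡ coeffβ k l → i ≡ k × j ≡ l
coeff-injective = from-yes (Fin.all? λ i → Fin.all? λ j → Fin.all? λ k → Fin.all? λ l →
  (coeffα i j Fin.≟ coeffα k l) →-dec (coeffβ i j Fin.≟ coeffβ k l) →-dec (i Fin.≟ k ×-dec j Fin.≟ l))

squareEntry : ℕ → ℕ → ℕ → Fin 3 → Fin 3 → ℕ
squareEntry g α β i j = suc (g ℕ.+ (toℕ (coeffα i j) ℕ.* α ℕ.+ toℕ (coeffβ i j) ℕ.* β))

square : ℕ → ℕ → ℕ → Matrix
square g α β = matrix (squareEntry g α β)

entry-square : ∀ g α β i j → entry (square g α β) i j ≡ squareEntry g α β i j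
entry-square g α β = entry-matrix (squareEntry g α β)

module _ {α β : ℕ} (0<β : 0 ℕ.< β) (β<α : β ℕ.< α) (α≢2β : α ≢ 2 ℕ.* β) where

  -- Since `β < α`, the right side exceeds the left except when `d = 0`, `j = 2`, `j′ = 0`; that
  -- case is `α ≡ 2 * β`.
  combination-≢ : ∀ d {j} j′ → j ℕ.≤ 2 → j ℕ.* β ≢ suc d ℕ.* α ℕ.+ j′ ℕ.* β
  combination-≢ zero {0} j′ _ eq = ℕ.<⇒≢ (ℕ.≤-trans (ℕ.≤-<-trans ℕ.z≤n β<α) (ℕ.m≤m+n α _))
    (trans eq (cong (ℕ._+ j′ ℕ.* β) (ℕ.*-identityˡ α)))
  combination-≢ zero {1} j′ _ eq = ℕ.<⇒≢ (ℕ.<-≤-trans β<α (ℕ.m≤m+n α _))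
    (trans (sym (ℕ.*-identityˡ β)) (trans eq (cong (ℕ._+ j′ ℕ.* β) (ℕ.*-identityˡ α))))
  combination-≢ zero {2} zero _ eq = α≢2β (sym (trans eq (trans (ℕ.+-identityʳ _) (ℕ.*-identityˡ α))))
  combination-≢ zero {2} (suc j′) _ eq =
    ℕ.<⇒≢ (ℕ.+-mono-<-≤ (subst (β ℕ.<_) (sym (ℕ.*-identityˡ α)) β<α) (ℕ.+-monoʳ-≤ β ℕ.z≤n)) eq
  combination-≢ (suc d) {j} j′ j≤2 = ℕ.<⇒≢ (begin-strict
    j ℕ.* β                     ≤⟨ ℕ.*-monoˡ-≤ β j≤2 ⟩
    2 ℕ.* β                     <⟨ ℕ.*-monoʳ-< 2 β<α ⟩
    2 ℕ.* α                     ≤⟨ ℕ.*-monoˡ-≤ α (ℕ.s≤s (ℕ.s≤s (ℕ.z≤n {d}))) ⟩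
    suc (suc d) ℕ.* α           ≤⟨ ℕ.m≤m+n _ _ ⟩
    suc (suc d) ℕ.* α ℕ.+ j′ ℕ.* β ∎)
    where open ℕ.≤-Reasoning
  combination-≢ _ {suc (suc (suc _))} _ (ℕ.s≤s (ℕ.s≤s ()))

  combination-< : ∀ {i i′ j} j′ → i ℕ.< i′ → j ℕ.≤ 2 → i ℕ.* α ℕ.+ j ℕ.* β ≢ i′ ℕ.* α ℕ.+ j′ ℕ.* β
  combination-< {i} {j = j} j′ i<i′ j≤2 eq with d , refl ← ℕ.m≤n⇒∃[o]m+o≡n i<i′ =
    combination-≢ d j′ j≤2 (ℕ.+-cancelˡ-≡ (i ℕ.* α) _ _ (trans eq (regroup i d α (j′ ℕ.* β))))
    where
    regroup : ∀ i d α b → suc (i ℕ.+ d) ℕ.* α ℕ.+ b ≡ i ℕ.* α ℕ.+ (suc d ℕ.* α ℕ.+ b)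
    regroup = ℕ-Solver.solve-∀

  combination-injective : ∀ {i i′ j j′} → j ℕ.≤ 2 → j′ ℕ.≤ 2 →
    i ℕ.* α ℕ.+ j ℕ.* β ≡ i′ ℕ.* α ℕ.+ j′ ℕ.* β → i ≡ i′ × j ≡ j′
  combination-injective {i} {i′} {j} {j′} j≤2 j′≤2 eq with ℕ.<-cmp i i′
  ... | tri< i<i′ _ _ = contradiction eq (combination-< j′ i<i′ j≤2)
  ... | tri> _ _ i>i′ = contradiction (sym eq) (combination-< j i>i′ j′≤2)
  ... | tri≈ _ refl _ = refl , ℕ.*-cancelʳ-≡ j j′ β {{ℕ.>-nonZero 0<β}} (ℕ.+-cancelˡ-≡ (i ℕ.* α) _ _ eq)

sum₃ : ∀ g α β a b a′ b′ a″ b″ →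
  suc (g ℕ.+ (a ℕ.* α ℕ.+ b ℕ.* β)) ℕ.+ (suc (g ℕ.+ (a′ ℕ.* α ℕ.+ b′ ℕ.* β)) ℕ.+ (suc (g ℕ.+ (a″ ℕ.* α ℕ.+ b″ ℕ.* β)) ℕ.+ 0))
  ≡ 3 ℕ.+ (3 ℕ.* g ℕ.+ ((a ℕ.+ (a′ ℕ.+ a″)) ℕ.* α ℕ.+ (b ℕ.+ (b′ ℕ.+ b″)) ℕ.* β))
sum₃ = ℕ-Solver.solve-∀

-- Centre [suc (g + α + β)], largest entry [t − suc h].
record Params : Set where
  constructor params
  field g h α β : ℕ

record Valid (t : ℕ) (π : Params) : Set where
  constructor mkValid
  open Params π
  field
    0<β  : 0 ℕ.< β
    β<α  : β ℕ.< α
    α≢2β : α ≢ 2 ℕ.* β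
    size : 2 ℕ.+ (g ℕ.+ (2 ℕ.* α ℕ.+ 2 ℕ.* β)) ℕ.+ h ≡ t

squareOf : Params → Matrix
squareOf (params g h α β) = square g α β

squareOf-canonical : ∀ {t} π → Valid t π → Canonical t (squareOf π)
squareOf-canonical {t} (params g h α β) (mkValid 0<β β<α α≢2β size) =
  (((magic , bounds) , d₁) , d₂) , d₃
  where
  bounds : EntriesStrictlyBetween 0 t (square g α β)
  bounds i j = subst (λ e → 0 ℕ.< e × e ℕ.< t) (sym (entry-square g α β i j)) (ℕ.z<s , (begin
    2 ℕ.+ (g ℕ.+ (toℕ (coeffα i j) ℕ.* α ℕ.+ toℕ (coeffβ i j) ℕ.* β))
      ≤⟨ ℕ.+-monoʳ-≤ (2 ℕ.+ g) (ℕ.+-mono-≤ (ℕ.*-monoˡ-≤ α (Fin.toℕ≤pred[n] (coeffα i j)))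
                                            (ℕ.*-monoˡ-≤ β (Fin.toℕ≤pred[n] (coeffβ i j)))) ⟩
    2 ℕ.+ (g ℕ.+ (2 ℕ.* α ℕ.+ 2 ℕ.* β))      ≤⟨ ℕ.m≤m+n _ h ⟩
    2 ℕ.+ (g ℕ.+ (2 ℕ.* α ℕ.+ 2 ℕ.* β)) ℕ.+ h ≡⟨ size ⟩
    t ∎))
    where open ℕ.≤-Reasoning

  distinct : ∀ i j k l → entry (square g α β) i j ≡ entry (square g α β) k l → i ≡ k × j ≡ l
  distinct i j k l eq =
    let (a≡ , b≡) = combination-injective 0<β β<α α≢2β {toℕ (coeffα i j)} {toℕ (coeffα k l)}
          (Fin.toℕ≤pred[n] (coeffβ i j)) (Fin.toℕ≤pred[n] (coeffβ k l))
          (ℕ.+-cancelˡ-≡ (suc g) _ _ (trans (sym (entry-square g α β i j)) (trans eq (entry-square g α β k l))))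
    in coeff-injective i j k l (Fin.toℕ-injective a≡) (Fin.toℕ-injective b≡)

  line : ∀ a b a′ b′ a″ b″ → _
  line = sum₃ g α β

  magic : IsMagic (square g α β)
  magic = record
    { positive     = λ i j → proj₁ (bounds i j)
    ; distinct     = distinct
    ; magicSum     = 3 ℕ.+ (3 ℕ.* g ℕ.+ (3 ℕ.* α ℕ.+ 3 ℕ.* β))
    -- The arguments are the pairs of `coeffα` and `coeffβ` along each line. Both kinds total 3 on
    -- every line, diagonals included.
    ; rows         = λ { 0F → line 2 1 0 0 1 2 ; 1F → line 0 2 1 1 2 0 ; 2F → line 1 0 2 2 0 1 }
    ; columns      = λ { 0F → line 2 1 0 2 1 0 ; 1F → line 0 0 1 1 2 2 ; 2F → line 1 2 2 0 0 1 }
    ; diagonal     = line 2 1 1 1 0 1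
    ; antidiagonal = line 1 2 1 1 1 0
    }

  d₁ : Descends 0F 0F 2F 2F (square g α β)
  d₁ = ℕ.+-monoʳ-< (suc g) (ℕ.+-monoˡ-< (1 ℕ.* β) (ℕ.<-≤-trans (ℕ.≤-<-trans ℕ.z≤n β<α) (ℕ.m≤m+n α _)))
  d₂ : Descends 0F 2F 2F 0F (square g α β)
  d₂ = ℕ.+-monoʳ-< (suc g) (ℕ.+-monoʳ-< (1 ℕ.* α) (ℕ.<-≤-trans 0<β (ℕ.m≤m+n β _)))
  d₃ : Descends 0F 0F 0F 2F (square g α β)
  d₃ = ℕ.+-monoʳ-< (suc g) (begin-strict
    1 ℕ.* α ℕ.+ 2 ℕ.* β       ≡⟨ left α β ⟩
    (α ℕ.+ β) ℕ.+ β           <⟨ ℕ.+-monoʳ-< (α ℕ.+ β) β<α ⟩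
    (α ℕ.+ β) ℕ.+ α           ≡⟨ right α β ⟩
    2 ℕ.* α ℕ.+ 1 ℕ.* β       ∎)
    where
    open ℕ.≤-Reasoning
    left : ∀ α β → 1 ℕ.* α ℕ.+ 2 ℕ.* β ≡ (α ℕ.+ β) ℕ.+ β
    left = ℕ-Solver.solve-∀
    right : ∀ α β → (α ℕ.+ β) ℕ.+ α ≡ 2 ℕ.* α ℕ.+ 1 ℕ.* β
    right = ℕ-Solver.solve-∀

-- Three entries give `g`, `α` and `β` in turn; `h` leaves no trace in the square and comes from the
-- common bound `t`.
squareOf-injective : ∀ {t a b} → Valid t a → Valid t b → squareOf a ≡ squareOf b → a ≡ b
squareOf-injective {a = params g h α β} {params g′ h′ α′ β′} (mkValid _ _ _ s) (mkValid _ _ _ s′) eq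
  with refl ← ℕ.+-cancelʳ-≡ 0 _ _ (ℕ.suc-injective (cong (λ A → entry A 0F 1F) eq))
  with refl ← ℕ.*-cancelˡ-≡ _ _ 1 (ℕ.+-cancelʳ-≡ 0 _ _ (ℕ.+-cancelˡ-≡ g _ _ (ℕ.suc-injective (cong (λ A → entry A 2F 0F) eq))))
  with refl ← ℕ.*-cancelˡ-≡ _ _ 1 (ℕ.+-cancelˡ-≡ g _ _ (ℕ.suc-injective (cong (λ A → entry A 2F 2F) eq)))
  with refl ← ℕ.+-cancelˡ-≡ (2 ℕ.+ (g ℕ.+ (2 ℕ.* α ℕ.+ 2 ℕ.* β))) h h′ (trans s (sym s′))
  = refl

-- Recovery of the parameters from a canonical square

vec₃ : ∀ {A : Set} {a b c a′ b′ c′ : A} → a ≡ a′ → b ≡ b′ → c ≡ c′ →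
       Vec._∷_ a (b ∷ c ∷ []) ≡ a′ ∷ b′ ∷ c′ ∷ []
vec₃ refl refl refl = refl

middle-unique : ∀ a b {m n s} → a ℕ.+ (m ℕ.+ (b ℕ.+ 0)) ≡ s → a ℕ.+ (n ℕ.+ (b ℕ.+ 0)) ≡ s → m ≡ n
middle-unique a b {m} {n} p q = ℕ.+-cancelʳ-≡ (b ℕ.+ 0) m n (ℕ.+-cancelˡ-≡ a _ _ (trans p (sym q)))

module _ {t : ℕ} (p q r s u v w y z : ℕ)
         (canonical : Canonical t ((p ∷ q ∷ r ∷ []) ∷ (s ∷ u ∷ v ∷ []) ∷ (w ∷ y ∷ z ∷ []) ∷ [])) where

  private
    m = proj₁ (proj₁ (proj₁ (proj₁ canonical)))
    bounds = proj₂ (proj₁ (proj₁ (proj₁ canonical)))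
    w<r = proj₂ (proj₁ canonical)
    r<p = proj₂ canonical
    open IsMagic m

    -- The two diagonals and the middle column together cover the top and bottom rows once and the
    -- centre three times.
    thrice-centre : u ℕ.+ (u ℕ.+ (u ℕ.+ 0)) ≡ magicSum
    thrice-centre = ℕ.+-cancelʳ-≡ (magicSum ℕ.+ magicSum) _ _ (begin
      u ℕ.+ (u ℕ.+ (u ℕ.+ 0)) ℕ.+ (magicSum ℕ.+ magicSum)
        ≡⟨ cong₂ (λ a b → u ℕ.+ (u ℕ.+ (u ℕ.+ 0)) ℕ.+ (a ℕ.+ b)) (rows 0F) (rows 2F) ⟨
      u ℕ.+ (u ℕ.+ (u ℕ.+ 0)) ℕ.+ ((p ℕ.+ (q ℕ.+ (r ℕ.+ 0))) ℕ.+ (w ℕ.+ (y ℕ.+ (z ℕ.+ 0))))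
        ≡⟨ regroup p q r u w y z ⟩
      (p ℕ.+ (u ℕ.+ (z ℕ.+ 0))) ℕ.+ ((r ℕ.+ (u ℕ.+ (w ℕ.+ 0))) ℕ.+ (q ℕ.+ (u ℕ.+ (y ℕ.+ 0))))
        ≡⟨ cong₂ ℕ._+_ diagonal (cong₂ ℕ._+_ antidiagonal (columns 1F)) ⟩
      magicSum ℕ.+ (magicSum ℕ.+ magicSum) ∎)
      where
      open ≡-Reasoning
      regroup : ∀ p q r u w y z →
        u ℕ.+ (u ℕ.+ (u ℕ.+ 0)) ℕ.+ ((p ℕ.+ (q ℕ.+ (r ℕ.+ 0))) ℕ.+ (w ℕ.+ (y ℕ.+ (z ℕ.+ 0)))) ≡
        (p ℕ.+ (u ℕ.+ (z ℕ.+ 0))) ℕ.+ ((r ℕ.+ (u ℕ.+ (w ℕ.+ 0))) ℕ.+ (q ℕ.+ (u ℕ.+ (y ℕ.+ 0))))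
      regroup = ℕ-Solver.solve-∀

    opposite-corners : ∀ a b → a ℕ.+ (u ℕ.+ (b ℕ.+ 0)) ≡ magicSum → a ℕ.+ b ≡ u ℕ.+ u
    opposite-corners a b eq = ℕ.+-cancelˡ-≡ u _ _ (trans (left a b u) (trans eq (trans (sym thrice-centre) (right u))))
      where
      left : ∀ a b u → u ℕ.+ (a ℕ.+ b) ≡ a ℕ.+ (u ℕ.+ (b ℕ.+ 0))
      left = ℕ-Solver.solve-∀
      right : ∀ u → u ℕ.+ (u ℕ.+ (u ℕ.+ 0)) ≡ u ℕ.+ (u ℕ.+ u)
      right = ℕ-Solver.solve-∀

    p+z≡2u : p ℕ.+ z ≡ u ℕ.+ u
    p+z≡2u = opposite-corners p z diagonal
    r+w≡2u : r ℕ.+ w ≡ u ℕ.+ u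
    r+w≡2u = opposite-corners r w antidiagonal

    q+r≡u+z : q ℕ.+ r ≡ u ℕ.+ z
    q+r≡u+z = trans (cong (q ℕ.+_) (sym (ℕ.+-identityʳ r)))
      (trans (ℕ.+-cancelˡ-≡ p _ _ (trans (rows 0F) (sym diagonal))) (cong (u ℕ.+_) (ℕ.+-identityʳ z)))

    u<r : u ℕ.< r
    u<r = ℕ.≰⇒> λ r≤u → ℕ.<⇒≢ (ℕ.<-≤-trans (ℕ.+-monoʳ-< r w<r) (ℕ.+-mono-≤ r≤u r≤u)) r+w≡2u

    q<z : q ℕ.< z
    q<z = ℕ.≰⇒> λ z≤q → ℕ.<⇒≢ (ℕ.+-mono-<-≤ u<r z≤q) (trans (sym q+r≡u+z) (ℕ.+-comm q r))

    z<w : z ℕ.< w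
    z<w = ℕ.≰⇒> λ w≤z → ℕ.<⇒≢ (ℕ.+-mono-<-≤ r<p w≤z) (trans r+w≡2u (sym p+z≡2u))

    -- With `z = q + β` and `w = q + α` this places the centre at `q + α + β`, from which the
    -- remaining entries follow.
    q+u≡z+w : q ℕ.+ u ≡ z ℕ.+ w
    q+u≡z+w = ℕ.+-cancelˡ-≡ u _ _ (begin
      u ℕ.+ (q ℕ.+ u) ≡⟨ regroup u q ⟩
      q ℕ.+ (u ℕ.+ u) ≡⟨ cong (q ℕ.+_) r+w≡2u ⟨
      q ℕ.+ (r ℕ.+ w) ≡⟨ ℕ.+-assoc q r w ⟨
      q ℕ.+ r ℕ.+ w   ≡⟨ cong (ℕ._+ w) q+r≡u+z ⟩
      u ℕ.+ z ℕ.+ w   ≡⟨ ℕ.+-assoc u z w ⟩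
      u ℕ.+ (z ℕ.+ w) ∎)
      where
      open ≡-Reasoning
      regroup : ∀ u q → u ℕ.+ (q ℕ.+ u) ≡ q ℕ.+ (u ℕ.+ u)
      regroup = ℕ-Solver.solve-∀

    -- The parameters are read off from the least entry q and the bottom corners.
    module _ {g β α h : ℕ} (q≡ : 1 ℕ.+ g ≡ q) (z≡′ : q ℕ.+ β ≡ z) (w≡′ : q ℕ.+ α ≡ w)
             (size′ : suc y ℕ.+ h ≡ t) where
      e = squareEntry g α β

      z≡ : e 2F 2F ≡ z
      z≡ = trans (form g α β) (trans (cong (ℕ._+ β) q≡) z≡′)
        where
        form : ∀ g α β → suc (g ℕ.+ (0 ℕ.* α ℕ.+ 1 ℕ.* β)) ≡ suc g ℕ.+ β
        form = ℕ-Solver.solve-∀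

      w≡ : e 2F 0F ≡ w
      w≡ = trans (form g α β) (trans (cong (ℕ._+ α) q≡) w≡′)
        where
        form : ∀ g α β → suc (g ℕ.+ (1 ℕ.* α ℕ.+ 0 ℕ.* β)) ≡ suc g ℕ.+ α
        form = ℕ-Solver.solve-∀

      u≡ : e 1F 1F ≡ u
      u≡ = ℕ.+-cancelˡ-≡ (suc g) _ _ (trans (form g α β)
        (trans (cong₂ ℕ._+_ z≡ w≡) (trans (sym q+u≡z+w) (cong (ℕ._+ u) (sym q≡)))))
        where
        form : ∀ g α β → suc g ℕ.+ suc (g ℕ.+ (1 ℕ.* α ℕ.+ 1 ℕ.* β)) ≡
          suc (g ℕ.+ (0 ℕ.* α ℕ.+ 1 ℕ.* β)) ℕ.+ suc (g ℕ.+ (1 ℕ.* α ℕ.+ 0 ℕ.* β))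
        form = ℕ-Solver.solve-∀

      r≡ : e 0F 2F ≡ r
      r≡ = ℕ.+-cancelˡ-≡ (suc g) _ _ (trans (form g α β)
        (trans (cong₂ ℕ._+_ u≡ z≡) (trans (sym q+r≡u+z) (cong (ℕ._+ r) (sym q≡)))))
        where
        form : ∀ g α β → suc g ℕ.+ suc (g ℕ.+ (1 ℕ.* α ℕ.+ 2 ℕ.* β)) ≡
          suc (g ℕ.+ (1 ℕ.* α ℕ.+ 1 ℕ.* β)) ℕ.+ suc (g ℕ.+ (0 ℕ.* α ℕ.+ 1 ℕ.* β))
        form = ℕ-Solver.solve-∀

      p≡ : e 0F 0F ≡ p
      p≡ = ℕ.+-cancelʳ-≡ (e 2F 2F) _ _ (trans (form g α β)
        (trans (cong₂ ℕ._+_ u≡ u≡) (trans (sym p+z≡2u) (cong (p ℕ.+_) (sym z≡)))))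
        where
        form : ∀ g α β → suc (g ℕ.+ (2 ℕ.* α ℕ.+ 1 ℕ.* β)) ℕ.+ suc (g ℕ.+ (0 ℕ.* α ℕ.+ 1 ℕ.* β)) ≡
          suc (g ℕ.+ (1 ℕ.* α ℕ.+ 1 ℕ.* β)) ℕ.+ suc (g ℕ.+ (1 ℕ.* α ℕ.+ 1 ℕ.* β))
        form = ℕ-Solver.solve-∀

      sum≡ : 3 ℕ.+ (3 ℕ.* g ℕ.+ (3 ℕ.* α ℕ.+ 3 ℕ.* β)) ≡ magicSum
      sum≡ = trans (sym (sum₃ g α β 1 1 1 1 1 1))
        (trans (cong (λ u → u ℕ.+ (u ℕ.+ (u ℕ.+ 0))) u≡) thrice-centre)

      middle≡ : ∀ {a b m a′ b′ m′} → a′ ≡ a → b′ ≡ b → a ℕ.+ (m ℕ.+ (b ℕ.+ 0)) ≡ magicSum →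
        a′ ℕ.+ (m′ ℕ.+ (b′ ℕ.+ 0)) ≡ 3 ℕ.+ (3 ℕ.* g ℕ.+ (3 ℕ.* α ℕ.+ 3 ℕ.* β)) → m′ ≡ m
      middle≡ {a} {b} refl refl line line′ = middle-unique a b (trans line′ sum≡) line

      s≡ : e 1F 0F ≡ s
      s≡ = middle≡ p≡ w≡ (columns 0F) (sum₃ g α β 2 1 0 2 1 0)
      v≡ : e 1F 2F ≡ v
      v≡ = middle≡ r≡ z≡ (columns 2F) (sum₃ g α β 1 2 2 0 0 1)
      y≡ : e 2F 1F ≡ y
      y≡ = middle≡ w≡ z≡ (rows 2F) (sum₃ g α β 1 0 2 2 0 1)

      0<β : 0 ℕ.< β
      0<β = ℕ.+-cancelˡ-< q 0 β (subst (ℕ._< q ℕ.+ β) (sym (ℕ.+-identityʳ q)) (subst (q ℕ.<_) (sym z≡′) q<z))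
      β<α : β ℕ.< α
      β<α = ℕ.+-cancelˡ-< q β α (subst₂ ℕ._<_ (sym z≡′) (sym w≡′) z<w)
      α≢2β : α ≢ 2 ℕ.* β
      -- The entries `s` and `w` are the least entry plus `2β` and plus `α`, so equality would put
      -- one number in two cells.
      α≢2β α≡2β with () , _ ← distinct 1F 0F 2F 0F (trans (sym s≡) (trans
        (cong (λ a → suc (g ℕ.+ a)) (sym (trans (ℕ.+-identityʳ (1 ℕ.* α)) (trans (ℕ.*-identityˡ α) α≡2β)))) w≡))

      square≡ : squareOf (params g h α β) ≡ ((p ∷ q ∷ r ∷ []) ∷ (s ∷ u ∷ v ∷ []) ∷ (w ∷ y ∷ z ∷ []) ∷ [])
      square≡ = vec₃ (vec₃ p≡ q≡′ r≡) (vec₃ s≡ u≡ v≡) (vec₃ w≡ y≡ z≡)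
        where
        q≡′ : e 0F 1F ≡ q
        q≡′ = trans (cong suc (ℕ.+-identityʳ g)) q≡

      valid : Valid t (params g h α β)
      valid = mkValid 0<β β<α α≢2β (trans (cong (λ b → suc b ℕ.+ h) y≡) size′)

  canonical-square : ∃ λ π → Valid t π ×
    ((p ∷ q ∷ r ∷ []) ∷ (s ∷ u ∷ v ∷ []) ∷ (w ∷ y ∷ z ∷ []) ∷ []) ≡ squareOf π
  canonical-square =
    let (g , q≡) = ℕ.m≤n⇒∃[o]m+o≡n (positive 0F 1F)
        (β , z≡) = ℕ.m≤n⇒∃[o]m+o≡n (ℕ.<⇒≤ q<z)
        (α , w≡) = ℕ.m≤n⇒∃[o]m+o≡n (ℕ.<⇒≤ (ℕ.<-trans q<z z<w))
        (h , size) = ℕ.m≤n⇒∃[o]m+o≡n (proj₂ (bounds 2F 1F))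
    in params g h α β , valid q≡ z≡ w≡ size , sym (square≡ q≡ z≡ w≡ size)

count-canonical : ∀ {t c} → Count (Valid t) c → Count (Canonical t) c
count-canonical = count-image squareOf squareOf-injective squareOf-canonical
  λ { ((p ∷ q ∷ r ∷ []) ∷ (s ∷ u ∷ v ∷ []) ∷ (w ∷ y ∷ z ∷ []) ∷ []) → canonical-square p q r s u v w y z }

-- The families α = 2β + (odd), α = 2β + (even) and β < α < 2β. The vector is
-- (g , h , f , p), where α − 2β = 2f + 1, resp. 2f + 2 and β = p + 1 in the
-- first two families, and α = 2(p + 1) + (f + 1), β = (p + 1) + (f + 1) in the last.

odd even between : Vec ℕ 4 → Params
odd     (g ∷ h ∷ f ∷ p ∷ []) = params g h (suc (2 ℕ.* suc p ℕ.+ 2 ℕ.* f)) (suc p)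
even    (g ∷ h ∷ f ∷ p ∷ []) = params g h (suc (suc (2 ℕ.* suc p ℕ.+ 2 ℕ.* f))) (suc p)
between (g ∷ h ∷ f ∷ p ∷ []) = params g h (suc p ℕ.+ (suc p ℕ.+ suc f)) (suc p ℕ.+ suc f)

2*-injective : ∀ {m n} → 2 ℕ.* m ≡ 2 ℕ.* n → m ≡ n
2*-injective {m} {n} = ℕ.*-cancelˡ-≡ m n 2

odd-injective : Injective _≡_ _≡_ odd
odd-injective {g ∷ h ∷ f ∷ p ∷ []} {_ ∷ _ ∷ f′ ∷ p′ ∷ []} eq
  with refl ← cong Params.g eq | refl ← cong Params.h eq | refl ← cong Params.β eq
  with refl ← 2*-injective {f} {f′} (ℕ.+-cancelˡ-≡ (2 ℕ.* suc p) _ _ (ℕ.suc-injective (cong Params.α eq)))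
  = refl

even-injective : Injective _≡_ _≡_ even
even-injective {g ∷ h ∷ f ∷ p ∷ []} {_ ∷ _ ∷ f′ ∷ p′ ∷ []} eq
  with refl ← cong Params.g eq | refl ← cong Params.h eq | refl ← cong Params.β eq
  with refl ← 2*-injective {f} {f′} (ℕ.+-cancelˡ-≡ (2 ℕ.* suc p) _ _ (ℕ.suc-injective (ℕ.suc-injective (cong Params.α eq))))
  = refl

between-injective : Injective _≡_ _≡_ between
between-injective {g ∷ h ∷ f ∷ p ∷ []} {_ ∷ _ ∷ f′ ∷ p′ ∷ []} eq
  with refl ← cong Params.g eq | refl ← cong Params.h eq
  with refl ← ℕ.suc-injective (ℕ.+-cancelʳ-≡ (suc p ℕ.+ suc f) (suc p) (suc p′)
    (trans (cong Params.α eq) (cong (suc p′ ℕ.+_) (sym (cong Params.β eq)))))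
  with refl ← ℕ.suc-injective (ℕ.+-cancelˡ-≡ (suc p) (suc f) (suc f′) (cong Params.β eq))
  = refl

InImage : (Vec ℕ 4 → Params) → ℕ → ℕ → Params → Set
InImage φ k t π = ∃ λ vs → k ℕ.+ Σ[ weights · vs ] ≡ t × π ≡ φ vs

-- The constants 10, 12 and 12 in these three identities belong to the smallest pairs `(α , β)` of
-- the families: `(3 , 1)`, `(4 , 1)` and `(3 , 2)`.
odd-weight : ∀ g h f p → 2 ℕ.+ (g ℕ.+ (2 ℕ.* suc (2 ℕ.* suc p ℕ.+ 2 ℕ.* f) ℕ.+ 2 ℕ.* suc p)) ℕ.+ h ≡
  10 ℕ.+ (g ℕ.* 1 ℕ.+ (h ℕ.* 1 ℕ.+ (f ℕ.* 4 ℕ.+ (p ℕ.* 6 ℕ.+ 0))))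
odd-weight = ℕ-Solver.solve-∀

even-weight : ∀ g h f p → 2 ℕ.+ (g ℕ.+ (2 ℕ.* suc (suc (2 ℕ.* suc p ℕ.+ 2 ℕ.* f)) ℕ.+ 2 ℕ.* suc p)) ℕ.+ h ≡
  12 ℕ.+ (g ℕ.* 1 ℕ.+ (h ℕ.* 1 ℕ.+ (f ℕ.* 4 ℕ.+ (p ℕ.* 6 ℕ.+ 0))))
even-weight = ℕ-Solver.solve-∀

between-weight : ∀ g h f p → 2 ℕ.+ (g ℕ.+ (2 ℕ.* (suc p ℕ.+ (suc p ℕ.+ suc f)) ℕ.+ 2 ℕ.* (suc p ℕ.+ suc f))) ℕ.+ h ≡
  12 ℕ.+ (g ℕ.* 1 ℕ.+ (h ℕ.* 1 ℕ.+ (f ℕ.* 4 ℕ.+ (p ℕ.* 6 ℕ.+ 0))))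
between-weight = ℕ-Solver.solve-∀

Beyond Between : Params → Set
Beyond  π = 2 ℕ.* Params.β π ℕ.< Params.α π
Between π = Params.α π ℕ.< 2 ℕ.* Params.β π

odd-beyond : ∀ vs → Beyond (odd vs)
odd-beyond (g ∷ h ∷ f ∷ p ∷ []) = ℕ.s≤s (ℕ.m≤m+n _ _)

even-beyond : ∀ vs → Beyond (even vs)
even-beyond (g ∷ h ∷ f ∷ p ∷ []) = ℕ.m≤n⇒m≤1+n (ℕ.s≤s (ℕ.m≤m+n _ _))

between-between : ∀ vs → Between (between vs)
between-between (g ∷ h ∷ f ∷ p ∷ []) = begin-strict
  suc p ℕ.+ (suc p ℕ.+ suc f)          <⟨ ℕ.+-monoˡ-< (suc p ℕ.+ suc f) (ℕ.m<m+n (suc p) ℕ.z<s) ⟩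
  suc p ℕ.+ suc f ℕ.+ (suc p ℕ.+ suc f) ≡⟨ cong (suc p ℕ.+ suc f ℕ.+_) (ℕ.+-identityʳ (suc p ℕ.+ suc f)) ⟨
  2 ℕ.* (suc p ℕ.+ suc f)              ∎
  where open ℕ.≤-Reasoning

2m<n⇒m<n : ∀ {m n} → 2 ℕ.* m ℕ.< n → m ℕ.< n
2m<n⇒m<n {m} = ℕ.≤-<-trans (ℕ.m≤m+n m _)

parity : ∀ n → ∃ λ f → n ≡ 2 ℕ.* f ⊎ n ≡ suc (2 ℕ.* f)
parity zero    = 0 , inj₁ refl
parity (suc n) with parity n
... | f , inj₁ refl = f , inj₂ refl
... | f , inj₂ refl = suc f , inj₁ (cong suc (sym (ℕ.+-suc f (f ℕ.+ 0))))

count-valid : ∀ t → Count (Valid t) (shift 10 parts₁₁₄₆ t + (shift 12 parts₁₁₄₆ t + shift 12 parts₁₁₄₆ t))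
count-valid t = count-⇔ to from
  (count-⊎ odd-disjoint (count-∃ odd odd-injective (count-shift Σ[ weights ·_] count-solutions 10 t))
    (count-⊎ even-disjoint (count-∃ even even-injective (count-shift Σ[ weights ·_] count-solutions 12 t))
      (count-∃ between between-injective (count-shift Σ[ weights ·_] count-solutions 12 t))))
  where
  Odd Even Mid : Params → Set
  Odd  = InImage odd 10 t
  Even = InImage even 12 t
  Mid  = InImage between 12 t

  even-disjoint : ∀ π → Even π → ¬ Mid π
  even-disjoint π (vs , _ , refl) (us , _ , eq) =
    ℕ.<-asym (even-beyond vs) (subst Between (sym eq) (between-between us))

  odd-disjoint : ∀ π → Odd π → ¬ (Even π ⊎ Mid π)
  odd-disjoint π (vs , _ , refl) (inj₂ (us , _ , eq)) =
    ℕ.<-asym (odd-beyond vs) (subst Between (sym eq) (between-between us))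
  odd-disjoint π ((g ∷ h ∷ f ∷ p ∷ []) , _ , refl) (inj₁ ((_ ∷ _ ∷ f′ ∷ _ ∷ []) , _ , eq))
    with refl ← cong Params.β eq =
    -- Once the `β` agree, `α - 2β` would be both odd and even.
    ℕ.even≢odd f f′ (ℕ.+-cancelˡ-≡ (2 ℕ.* suc p) _ _
      (trans (ℕ.suc-injective (cong Params.α eq)) (sym (ℕ.+-suc (2 ℕ.* suc p) _))))

  to : ∀ π → Odd π ⊎ Even π ⊎ Mid π → Valid t π
  to _ (inj₁ (vs@(g ∷ h ∷ f ∷ p ∷ []) , eq , refl)) =
    mkValid ℕ.z<s (2m<n⇒m<n (odd-beyond vs)) (ℕ.<⇒≢ (odd-beyond vs) ∘ sym) (trans (odd-weight g h f p) eq)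
  to _ (inj₂ (inj₁ (vs@(g ∷ h ∷ f ∷ p ∷ []) , eq , refl))) =
    mkValid ℕ.z<s (2m<n⇒m<n (even-beyond vs)) (ℕ.<⇒≢ (even-beyond vs) ∘ sym) (trans (even-weight g h f p) eq)
  to _ (inj₂ (inj₂ (vs@(g ∷ h ∷ f ∷ p ∷ []) , eq , refl))) =
    mkValid ℕ.z<s (ℕ.m<n+m _ ℕ.z<s) (ℕ.<⇒≢ (between-between vs)) (trans (between-weight g h f p) eq)

  from : ∀ π → Valid t π → Odd π ⊎ Even π ⊎ Mid π
  from (params g h α (suc p)) (mkValid _ β<α α≢2β size) with ℕ.<-cmp α (2 ℕ.* suc p)
  ... | tri≈ _ α≡2β _ = contradiction α≡2β α≢2β
  ... | tri> _ _ α>2β with ℕ.m≤n⇒∃[o]m+o≡n α>2β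
  -- Here `α = 2β + 1 + k`, so an even `k` leads to the odd family and an odd `k` to the even one.
  ...   | k , α≡ with parity k
  ...     | f , inj₁ refl = inj₁ (from-odd f (sym α≡) size)
    where
    from-odd : ∀ {α} f → α ≡ suc (2 ℕ.* suc p ℕ.+ 2 ℕ.* f) → 2 ℕ.+ (g ℕ.+ (2 ℕ.* α ℕ.+ 2 ℕ.* suc p)) ℕ.+ h ≡ t →
               Odd (params g h α (suc p))
    from-odd f refl size = (g ∷ h ∷ f ∷ p ∷ []) , trans (sym (odd-weight g h f p)) size , refl
  ...     | f , inj₂ refl = inj₂ (inj₁ (from-even f (trans (sym α≡) (cong suc (ℕ.+-suc (2 ℕ.* suc p) _))) size))
    where
    from-even : ∀ {α} f → α ≡ suc (suc (2 ℕ.* suc p ℕ.+ 2 ℕ.* f)) → 2 ℕ.+ (g ℕ.+ (2 ℕ.* α ℕ.+ 2 ℕ.* suc p)) ℕ.+ h ≡ t →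
                Even (params g h α (suc p))
    from-even f refl size = (g ∷ h ∷ f ∷ p ∷ []) , trans (sym (even-weight g h f p)) size , refl
  from (params g h α β@(suc b)) (mkValid _ β<α α≢2β size) | tri< α<2β _ _
    -- The first gap gives `α = β + (p + 1)`. Then `α < 2β` says `p + 1 < β`, and this second gap
    -- gives `f`.
    with p , refl ← ℕ.m≤n⇒∃[o]m+o≡n β<α
    with f , eq ← ℕ.m≤n⇒∃[o]m+o≡n (ℕ.+-cancelˡ-< β (suc p) β
           (subst₂ ℕ._<_ (sym (ℕ.+-suc β p)) (cong (β ℕ.+_) (ℕ.+-identityʳ β)) α<2β))
    = inj₂ (inj₂ (from-between f p (cong suc (ℕ.+-comm β p)) (trans (sym eq) (sym (ℕ.+-suc (suc p) f))) size))
    where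
    from-between : ∀ {α β} f p → α ≡ suc p ℕ.+ β → β ≡ suc p ℕ.+ suc f →
      2 ℕ.+ (g ℕ.+ (2 ℕ.* α ℕ.+ 2 ℕ.* β)) ℕ.+ h ≡ t → Mid (params g h α β)
    from-between f p refl refl size = (g ∷ h ∷ f ∷ p ∷ []) , trans (sym (between-weight g h f p)) size , refl

-- The generating function and the closed formula

M-c-series : ∀ t → + M-c t ≡ (numerator *ₛ parts₁₁₄₆) t
M-c-series t = trans
  (count-unique magicBelow (count-magicBelow (count-canonical (count-valid t))))
  -- The numerator is read off here: 8 from the orbits, `x^10` from the odd family, `2x^12` from the
  -- other two.
  (trans (octuple (shift 10 parts₁₁₄₆ t + (shift 12 parts₁₁₄₆ t + shift 12 parts₁₁₄₆ t)))
  (trans (cong (+ 8 *_) (regroup (shift 10 parts₁₁₄₆ t) (shift 12 parts₁₁₄₆ t)))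
    (sym (numerator-*ₛ parts₁₁₄₆ t))))
  where
  magicBelow : Count (MagicBelow t) (+ M-c t)
  magicBelow = record
    { elements = magicSquares t
    ; unique   = magicSquares-unique t
    ; member   = ∈-magicSquares t
    ; size     = refl
    }
  octuple : ∀ c → ((c + c) + (c + c)) + ((c + c) + (c + c)) ≡ + 8 * c
  octuple = solve-∀
  regroup : ∀ a b → a + (b + b) ≡ + 2 * b + a
  regroup = solve-∀

-- The form with cleared denominator feeds both halves of the theorem through `divide-unique`.
M-c-*ₛ : (λ t → + M-c t) *ₛ denominator ≈ₛ numerator
M-c-*ₛ n = begin
  ((λ t → + M-c t) *ₛ denominator) n ≡⟨ *ₛ-congʳ denominator {λ t → + M-c t} {numerator *ₛ parts₁₁₄₆} M-c-series n ⟩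
  ((numerator *ₛ parts₁₁₄₆) *ₛ denominator) n ≡⟨ *ₛ-assoc numerator parts₁₁₄₆ denominator n ⟩
  (numerator *ₛ (parts₁₁₄₆ *ₛ denominator)) n ≡⟨ *ₛ-congˡ numerator {parts₁₁₄₆ *ₛ denominator} {1ₛ} parts-*ₛ-denominator n ⟩
  (numerator *ₛ 1ₛ) n                ≡⟨ *ₛ-1ₛ numerator n ⟩
  numerator n                        ∎
  where open ≡-Reasoning

mainTheorem1 :
  (∑>0 M-c ≈ₛ
      (const (+ 8) *ₛ x ^ₛ 10 *ₛ (const (+ 2) *ₛ x ^ₛ 2 +ₛ const (+ 1)))
      /ₛ ((const (+ 1) -ₛ x) ^ₛ 2 *ₛ (const (+ 1) -ₛ x ^ₛ 4) *ₛ (const (+ 1) -ₛ x ^ₛ 6)))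
  ×
  (∀ (t : ℕ) → 1 ≤ t →
      (t % 12 ∈ 0 ∷ 2 ∷ 6 ∷ 8 ∷ [] →
        (+ M-c t) / 1 ≡ ((+ t) ^ 3 - + 16 * (+ t) ^ 2 + + 76 * + t - + 96) / 6)
    × (t % 12 ∈ 1 ∷ [] →
        (+ M-c t) / 1 ≡ ((+ t) ^ 3 - + 16 * (+ t) ^ 2 + + 73 * + t - + 58) / 6)
    × (t % 12 ∈ 3 ∷ 11 ∷ [] →
        (+ M-c t) / 1 ≡ ((+ t) ^ 3 - + 16 * (+ t) ^ 2 + + 73 * + t - + 102) / 6)
    × (t % 12 ∈ 4 ∷ 10 ∷ [] →
        (+ M-c t) / 1 ≡ ((+ t) ^ 3 - + 16 * (+ t) ^ 2 + + 76 * + t - + 112) / 6)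
    × (t % 12 ∈ 5 ∷ 9 ∷ [] →
        (+ M-c t) / 1 ≡ ((+ t) ^ 3 - + 16 * (+ t) ^ 2 + + 73 * + t - + 90) / 6)
    × (t % 12 ∈ 7 ∷ [] →
        (+ M-c t) / 1 ≡ ((+ t) ^ 3 - + 16 * (+ t) ^ 2 + + 73 * + t - + 70) / 6))
mainTheorem1 = generatingFunction , λ t 1≤t →
    (λ { (here eq) → value t 1≤t eq
       ; (there (here eq)) → value t 1≤t eq
       ; (there (there (here eq))) → value t 1≤t eq
       ; (there (there (there (here eq)))) → value t 1≤t eq })
  , (λ { (here eq) → value t 1≤t eq })
  , (λ { (here eq) → value t 1≤t eq
       ; (there (here eq)) → value t 1≤t eq })
  , (λ { (here eq) → value t 1≤t eq
       ; (there (here eq)) → value t 1≤t eq })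
  , (λ { (here eq) → value t 1≤t eq
       ; (there (here eq)) → value t 1≤t eq })
  , (λ { (here eq) → value t 1≤t eq })
  where
  generatingFunction : ∑>0 M-c ≈ₛ divide numerator denominator
  -- `∑>0` has constant term 0 by definition, and the constant term of the quotient is that of
  -- `numerator`, also 0.
  generatingFunction zero    = refl
  generatingFunction (suc n) = divide-unique {λ t → + M-c t} {numerator} {denominator} refl M-c-*ₛ (suc n)

  value : ∀ t {r} → 1 ≤ t → t % 12 ≡ r → (+ M-c t) / 1 ≡ cubic (linearCoeff r) (constantCoeff r) (+ t) / 6
  value (suc t) {r} _ eq =
    -- For a literal residue `r` the two coefficients compute, and `cubic` becomes the polynomial of
    -- the matching case.
    6*≡⇒≡/6 {+ M-c (suc t)} {cubic (linearCoeff r) (constantCoeff r) (+ suc t)}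
      (trans (6·-closed {λ n → + M-c n} M-c-*ₛ t) (closedForm-% (suc t) eq))
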